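{- $\mathrm{AVG}_\tau\mathrm{LCL}(O(1))\subseteq\mathrm{BPP}$.
   Context: A catalytic-tape machine has a read-only input tape, a write-only output tape, a read-write work tape of $s$ bits and a read-write catalytic tape of $c$ bits with arbitrary initial content $\tau\in\{0,1\}^c$. $\mathrm{AVG}_\tau\mathrm{LCL}(O(1))$ is the class of languages $L$ such that for some constants $k,C$ there is a deterministic such machine with $s=k\log n$ and $c=n^k$ that on every input $x$ of length $n$ and every $\tau$ outputs $L(x)$, and, writing $\tau'$ for the final catalytic content, $\mathbb E_\tau[d(\tau,\tau')]\le C$, where $\tau$ is uniform in $\{0,1\}^c$ and $d$ is Hamming distance. -}

module Defs where

open import Data.Bool using (Bool; true; false; if_then_else_; _xor_)
open import Data.Nat using (ℕ; zero; suc; _+_; _*_; _∸_; _^_; _≤_; _≤ᵇ_)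
open import Data.Nat.Logarithm using (⌈log₂_⌉)
open import Data.List using (List; []; _∷_; length; map; _++_)
open import Data.Nat.ListAction using (sum)
open import Data.Vec using (Vec; []; _∷_; replicate)
open import Data.Fin using (Fin)
open import Data.Maybe using (Maybe; just; nothing)
open import Data.Product using (Σ; _×_; _,_; proj₁; proj₂)
open import Relation.Binary.PropositionalEquality using (_≡_)

data Move : Set where
  left stay right : Move

move : Move → (maxIdx : ℕ) → ℕ → ℕ
move left _ i = i ∸ 1
move stay _ i = i
move right m i = if suc i ≤ᵇ m then suc i else i

-- read a cell of a finite binary tape (cells outside the tape read as 0)
readV : ∀ {m} → Vec Bool m → ℕ → Bool
readV []       _       = false
readV (b ∷ _)  zero    = b
readV (_ ∷ bs) (suc i) = readV bs i

writeV : ∀ {m} → Vec Bool m → ℕ → Bool → Vec Bool m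
writeV []       _       _ = []
writeV (_ ∷ bs) zero    b = b ∷ bs
writeV (c ∷ bs) (suc i) b = c ∷ writeV bs i b

-- read-only input tape with end markers: cell 0 and cell n+1 hold the
-- end marker (nothing), cell i (1 ≤ i ≤ n) holds the i-th input bit
readList : List Bool → ℕ → Maybe Bool
readList []       _       = nothing
readList (b ∷ _)  zero    = just b
readList (_ ∷ bs) (suc i) = readList bs i

readIn : List Bool → ℕ → Maybe Bool
readIn x zero    = nothing
readIn x (suc i) = readList x i

hamming : ∀ {m} → Vec Bool m → Vec Bool m → ℕ
hamming []       []       = 0
hamming (a ∷ as) (b ∷ bs) = (if a xor b then 1 else 0) + hamming as bs

allVecs : (m : ℕ) → List (Vec Bool m)
allVecs zero    = [] ∷ []
allVecs (suc m) = map (true ∷_) (allVecs m) ++ map (false ∷_) (allVecs m)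

iter : ∀ {A : Set} → ℕ → (A → A) → A → A
iter zero    f a = a
iter (suc t) f a = f (iter t f a)

Language : Set
Language = List Bool → Bool

-- A deterministic machine with a read-only input tape, a read-write work
-- tape and a read-write catalytic tape.  The output (the single bit L(x))
-- is given by the halting state: halt q = just b means q is a halting
-- state with output b; halting states are absorbing.
record CatMachine : Set where
  field
    Q     : ℕ
    start : Fin Q
    halt  : Fin Q → Maybe Bool
    -- (state, input symbol, work bit, catalytic bit) ↦
    -- (new state, work bit written, catalytic bit written,
    --  input-head move, work-head move, catalytic-head move)
    δ     : Fin Q → Maybe Bool → Bool → Bool → Fin Q × Bool × Bool × Move × Move × Move

record CatConfig (s c : ℕ) (Q : ℕ) : Set where
  constructor cfg
  field
    state : Fin Q
    inPos : ℕ
    work  : Vec Bool s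
    wPos  : ℕ
    cat   : Vec Bool c
    cPos  : ℕ

module _ (M : CatMachine) where
  open CatMachine M

  catStep : ∀ {s c} → List Bool → CatConfig s c Q → CatConfig s c Q
  catStep {s} {c} x k@(cfg q i w wi τ ci) with halt q
  ... | just _  = k
  ... | nothing with δ q (readIn x i) (readV w wi) (readV τ ci)
  ...   | q' , bw , bc , mi , mw , mc =
          cfg q' (move mi (suc (length x)) i)
                 (writeV w wi bw) (move mw (s ∸ 1) wi)
                 (writeV τ ci bc) (move mc (c ∸ 1) ci)

  -- number of steps after which a halting computation has certainly halted:
  -- an upper bound on the number of configurations
  catFuel : (n s c : ℕ) → ℕ
  catFuel n s c = Q * (n + 2) * (s + 1) * 2 ^ s * (c + 1) * 2 ^ c

  catFinal : (x : List Bool) (s c : ℕ) → Vec Bool c → CatConfig s c Q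
  catFinal x s c τ =
    iter (catFuel (length x) s c) (catStep x)
         (cfg start 0 (replicate s false) 0 τ 0)

  catOutput : (x : List Bool) (s c : ℕ) → Vec Bool c → Maybe Bool
  catOutput x s c τ = halt (CatConfig.state (catFinal x s c τ))

  catFinalTape : (x : List Bool) (s c : ℕ) → Vec Bool c → Vec Bool c
  catFinalTape x s c τ = CatConfig.cat (catFinal x s c τ)

workSpace : ℕ → ℕ → ℕ
workSpace k n = k * ⌈log₂ n ⌉

catSpace : ℕ → ℕ → ℕ
catSpace k n = n ^ k

-- L ∈ AVG_τ LCL(O(1)):  E_τ[d(τ,τ')] ≤ C is written as
-- Σ_τ d(τ,τ') ≤ C · 2^c  (τ uniform over {0,1}^c)
AvgCatLCL : Language → Set
AvgCatLCL L =
  Σ ℕ λ k → Σ ℕ λ C → Σ CatMachine λ M →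
    ((x : List Bool) (τ : Vec Bool (catSpace k (length x))) →
       catOutput M x (workSpace k (length x)) (catSpace k (length x)) τ ≡ just (L x))
    × ((x : List Bool) →
       sum (map (λ τ → hamming τ (catFinalTape M x (workSpace k (length x)) (catSpace k (length x)) τ))
                (allVecs (catSpace k (length x))))
         ≤ C * 2 ^ catSpace k (length x))

-- BPP: probabilistic polynomial-time machines (random bits on a
-- read-only random tape), bounded error 1/3

record ProbMachine : Set where
  field
    Q     : ℕ
    start : Fin Q
    halt  : Fin Q → Maybe Bool
    -- (state, input symbol, work bit, random bit) ↦
    -- (new state, work bit written, input-head move, work-head move,
    --  random-head move)
    δ     : Fin Q → Maybe Bool → Bool → Bool → Fin Q × Bool × Move × Move × Move

record ProbConfig (t : ℕ) (Q : ℕ) : Set where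
  constructor pcfg
  field
    state : Fin Q
    inPos : ℕ
    work  : Vec Bool t
    wPos  : ℕ
    rPos  : ℕ

module _ (M : ProbMachine) where
  open ProbMachine M

  probStep : ∀ {t} → List Bool → Vec Bool t → ProbConfig t Q → ProbConfig t Q
  probStep {t} x r k@(pcfg q i w wi ri) with halt q
  ... | just _  = k
  ... | nothing with δ q (readIn x i) (readV w wi) (readV r ri)
  ...   | q' , bw , mi , mw , mr =
          pcfg q' (move mi (suc (length x)) i)
                  (writeV w wi bw) (move mw (t ∸ 1) wi)
                  (move mr (t ∸ 1) ri)

  probOutput : (x : List Bool) (t : ℕ) → Vec Bool t → Maybe Bool
  probOutput x t r =
    halt (ProbConfig.state (iter t (probStep x r) (pcfg start 0 (replicate t false) 0 0)))

countOut : ∀ {t} → (Vec Bool t → Maybe Bool) → Bool → List (Vec Bool t) → ℕ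
countOut f b [] = 0
countOut f b (r ∷ rs) with f r
... | just true  = (if b then 1 else 0) + countOut f b rs
... | just false = (if b then 0 else 1) + countOut f b rs
... | nothing    = countOut f b rs

polyTime : ℕ → ℕ → ℕ
polyTime k n = n ^ k + k

BPP : Language → Set
BPP L =
  Σ ℕ λ k → Σ ProbMachine λ M →
    ((x : List Bool) (r : Vec Bool (polyTime k (length x))) →
        Σ Bool λ b → probOutput M x (polyTime k (length x)) r ≡ just b)
    × ((x : List Bool) →
        2 * 2 ^ polyTime k (length x)
          ≤ 3 * countOut (probOutput M x (polyTime k (length x))) (L x)
                         (allVecs (polyTime k (length x))))

{-# OPTIONS --safe #-}

-- The probabilistic machine takes a prefix of its random tape as catalytic
-- content τ, simulates the catalytic machine for polynomially many steps T and
-- gives up if it has not halted by then.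
--
-- By Markov's inequality all but a sixth of the tapes are changed in at most
-- D = 6(C + 1) places.  If such a tape τ has not halted after T steps, then the
-- pair (τ, t), t < T, can be recovered from the configuration reached at time t
-- together with D bit positions: the configuration determines the final tape,
-- flipping the D positions gives τ, and a halting run visits no configuration
-- twice.  So there are at most poly(n) · 2^c pairs, and for a suitable
-- polynomial T at most a sixth of the tapes are of this kind.
--
-- The simulation goes through a register machine whose registers are kept in
-- unary on parallel tracks of the binary work tape: after m steps every register
-- is at most m, so the overhead is polynomial.  The catalytic content is stored
-- as its difference from the read-only random tape.
module Submission where

open import Defs

open import Data.Bool using (Bool; true; false; if_then_else_; T; not; _∧_; _xor_)
open import Data.Bool.Properties using (T?; T-∧)
open import Data.Fin using (Fin; toℕ; fromℕ<)
open import Data.Fin.Patterns using (0F; 1F; 2F; 3F; 4F; 5F; 6F)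
open import Data.Fin.Properties using (1↔⊤; 2↔Bool; +↔⊎; *↔×; injective⇒≤; toℕ<n; toℕ-injective; fromℕ<-injective)
open import Data.List using (List; []; _∷_; length; _++_)
import Data.List as List
open import Data.List.Membership.Propositional using (_∈_)
open import Data.List.Membership.Propositional.Properties using (∈-lookup; ∈-map⁻)
open import Data.List.Properties using (length-++; length-map)
import Data.List.Relation.Unary.All as All
open import Data.List.Relation.Unary.All.Properties using (all-filter)
open import Data.List.Relation.Unary.AllPairs using ([]; _∷_)
open import Data.List.Relation.Unary.Unique.Propositional using (Unique)
import Data.List.Relation.Unary.Unique.Propositional.Properties as Unique
open import Data.Maybe using (Maybe; just; nothing; is-just; is-nothing; fromMaybe)
import Data.Maybe as Maybe
open import Data.Nat using (ℕ; zero; suc; pred; _+_; _*_; _∸_; _^_; _≤_; _<_; z≤n; s≤s; s≤s⁻¹; _≡ᵇ_; _≤ᵇ_; _<ᵇ_; ⌊_/2⌋; ⌈_/2⌉)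
open import Data.Nat.Induction using (<-wellFounded)
open import Data.Nat.ListAction using (sum)
open import Data.Nat.Logarithm using (⌈log₂_⌉)
open import Data.Nat.Logarithm.Core using (⌈log2⌉-acc-irrelevant)
open import Data.Nat.Properties
open import Data.Nat.Tactic.RingSolver using (solve-∀)
open import Data.Product using (Σ; _×_; _,_; proj₁; proj₂; map₁)
open import Data.Product.Function.NonDependent.Propositional using (_×-↔_)
open import Data.Sum using (_⊎_; inj₁; inj₂)
open import Data.Sum.Function.Propositional using (_⊎-↔_)
open import Data.Unit using (⊤; tt)
open import Data.Vec using (Vec; []; _∷_; lookup; map; updateAt; _[_]≔_; replicate; uncons; tail)
open import Data.Vec.Properties using (lookup-map; map-replicate; lookup-replicate; ∷-injectiveʳ)
open import Function using (_∘_)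
open import Function.Bundles using (_↔_; Inverse; Equivalence; mk↔ₛ′)
open import Function.Construct.Composition using (_↔-∘_)
open import Function.Construct.Identity using (↔-id)
open import Function.Construct.Symmetry using (↔-sym)
open import Function.Definitions using (Injective)
open import Induction.WellFounded using (Acc; acc)
open import Relation.Binary.Definitions using (tri<; tri≈; tri>)
open import Relation.Binary.PropositionalEquality
open import Relation.Nullary using (¬_; yes; no; contradiction)

-- Structured programs

-- The average bound limits no single run: a tape may be changed in many places or keep the machine
-- running exponentially long. Only a count over all tapes helps. Tapes far from their final content
-- and near tapes still running at the deadline get at most one sixth each, together the permitted
-- third. A run that halts in time is right, since the catalytic machine is correct on every tape.
-- Two exponents are kept apart. The deadline `polyTime K n` comes from the count of configurations
-- and does not depend on the simulator. The length `polyTime E n` of the random tape, which is also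
-- the length of the work tape and the number of steps, is chosen afterwards to cover the cost of
-- simulation; a prefix of a uniform tape is uniform, so the surplus is harmless. The catalytic
-- machine behaves differently at the ends of its tapes, whose lengths depend on `n`. Hence the
-- simulator first computes the deadline and both lengths from the input tape. Storing a difference
-- spares it copying `τ`: the array for the difference may start at zero.

infixr 5 _⨾_

data Prog (V A : Set) : Set where
  act   : A → Prog V A
  _⨾_   : Prog V A → Prog V A → Prog V A
  ite   : (V → Bool) → Prog V A → Prog V A → Prog V A
  while : (V → Bool) → Prog V A → Prog V A

-- Tests see only `val s`, the part of the state kept in the finite control, so at every level a
-- test is answered without touching a tape or register.
record Model (V A : Set) : Set₁ where
  field
    S   : Set
    val : S → V
    app : A → S → S

-- The number in Run is only an upper bound on the running time.
data Run {V A : Set} (𝓜 : Model V A) : Prog V A → Model.S 𝓜 → ℕ → Model.S 𝓜 → Set where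
  act         : ∀ {a s} → Run 𝓜 (act a) s 1 (Model.app 𝓜 a s)
  seq         : ∀ {P Q s s′ s″ m n} → Run 𝓜 P s m s′ → Run 𝓜 Q s′ n s″ → Run 𝓜 (P ⨾ Q) s (m + n) s″
  ite-true    : ∀ {c P Q s s′ m} → c (Model.val 𝓜 s) ≡ true → Run 𝓜 P s m s′ → Run 𝓜 (ite c P Q) s (suc m) s′
  ite-false   : ∀ {c P Q s s′ m} → c (Model.val 𝓜 s) ≡ false → Run 𝓜 Q s m s′ → Run 𝓜 (ite c P Q) s (suc m) s′
  while-false : ∀ {c P s} → c (Model.val 𝓜 s) ≡ false → Run 𝓜 (while c P) s 1 s
  while-true  : ∀ {c P s s′ s″ m n} → c (Model.val 𝓜 s) ≡ true →
                Run 𝓜 P s m s′ → Run 𝓜 (while c P) s′ n s″ → Run 𝓜 (while c P) s (suc (m + n)) s″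
  slack       : ∀ {P s s′ m n} → m ≤ n → Run 𝓜 P s m s′ → Run 𝓜 P s n s′

compile : ∀ {V₁ A₁ V₂ A₂ : Set} → (V₁ → V₂) → (A₂ → Prog V₁ A₁) → Prog V₂ A₂ → Prog V₁ A₁
compile h code (act a)     = code a
compile h code (P ⨾ Q)     = compile h code P ⨾ compile h code Q
compile h code (ite c P Q) = ite (c ∘ h) (compile h code P) (compile h code Q)
compile h code (while c P) = while (c ∘ h) (compile h code P)

-- The relation R is indexed by the time already spent: a register machine
-- can only have written numbers up to that bound, which is what makes the
-- cost K of simulating one instruction uniform up to time N.
record Refines {V₁ A₁ V₂ A₂ : Set} (𝓒 : Model V₁ A₁) (𝓐 : Model V₂ A₂) (N K : ℕ) : Set₁ where
  field
    h    : V₁ → V₂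
    code : A₂ → Prog V₁ A₁
    R    : ℕ → Model.S 𝓒 → Model.S 𝓐 → Set
    val≡ : ∀ {b σ s} → R b σ s → h (Model.val 𝓒 σ) ≡ Model.val 𝓐 s
    mono : ∀ {b b′ σ s} → b ≤ b′ → R b σ s → R b′ σ s
    sim  : ∀ a {b σ s} → b < N → R b σ s →
           Σ (Model.S 𝓒) λ σ′ → Run 𝓒 (code a) σ K σ′ × R (suc b) σ′ (Model.app 𝓐 a s)

module _ {V₁ A₁ V₂ A₂ : Set} {𝓒 : Model V₁ A₁} {𝓐 : Model V₂ A₂} {N K : ℕ} (ref : Refines 𝓒 𝓐 N K) where
  open Refines ref

  private
    test-cost : ∀ m → suc (suc K * m) ≤ suc K * suc m
    test-cost m = ≤-trans (s≤s (m≤n+m (suc K * m) K)) (≤-reflexive (sym (*-suc (suc K) m)))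

  -- The factor is `suc K` and not `K` so that the single step of a test is covered even for `K`
  -- equal to zero. The hypothesis `b + m ≤ N` keeps every instruction in the range where the cost
  -- `K` is valid.
  refine : ∀ {P s m s′ b σ} → Run 𝓐 P s m s′ → b + m ≤ N → R b σ s →
           Σ (Model.S 𝓒) λ σ′ → Run 𝓒 (compile h code P) σ (suc K * m) σ′ × R (b + m) σ′ s′
  refine {b = b} act le r with sim _ (subst (_≤ N) (+-comm b 1) le) r
  ... | σ′ , run , r′ =
    σ′ , slack (≤-trans (n≤1+n K) (≤-reflexive (sym (*-identityʳ (suc K))))) run
       , mono (≤-reflexive (+-comm 1 b)) r′
  refine {b = b} (seq {m = m} {n} p q) le r
    with refine p (≤-trans (+-monoʳ-≤ b (m≤m+n m n)) le) r
  ... | σ₁ , run₁ , r₁ with refine q (subst (_≤ N) (sym (+-assoc b m n)) le) r₁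
  ... | σ₂ , run₂ , r₂ =
    σ₂ , slack (≤-reflexive (sym (*-distribˡ-+ (suc K) m n))) (seq run₁ run₂)
       , mono (≤-reflexive (+-assoc b m n)) r₂
  refine {b = b} (ite-true {c} {m = m} e p) le r
    with refine p (subst (_≤ N) (+-suc b m) le) (mono (n≤1+n b) r)
  ... | σ₁ , run₁ , r₁ =
    σ₁ , slack (test-cost m) (ite-true (trans (cong c (val≡ r)) e) run₁)
       , mono (≤-reflexive (sym (+-suc b m))) r₁
  refine {b = b} (ite-false {c} {m = m} e p) le r
    with refine p (subst (_≤ N) (+-suc b m) le) (mono (n≤1+n b) r)
  ... | σ₁ , run₁ , r₁ =
    σ₁ , slack (test-cost m) (ite-false (trans (cong c (val≡ r)) e) run₁)
       , mono (≤-reflexive (sym (+-suc b m))) r₁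
  refine {b = b} {σ = σ} (while-false {c} e) le r =
    σ , slack (s≤s z≤n) (while-false (trans (cong c (val≡ r)) e)) , mono (m≤m+n b 1) r
  refine {b = b} (while-true {c} {m = m} {n} e p q) le r
    with refine p (≤-trans (≤-trans (≤-reflexive (sym (+-suc b m))) (+-monoʳ-≤ b (s≤s (m≤m+n m n)))) le)
                  (mono (n≤1+n b) r)
  ... | σ₁ , run₁ , r₁
    with refine q (subst (_≤ N) (trans (+-suc b (m + n)) (cong suc (sym (+-assoc b m n)))) le) r₁
  ... | σ₂ , run₂ , r₂ =
    σ₂ , slack (≤-trans (≤-reflexive (cong suc (sym (*-distribˡ-+ (suc K) m n)))) (test-cost (m + n)))
               (while-true (trans (cong c (val≡ r)) e) run₁ run₂)
       , mono (≤-reflexive (trans (cong suc (+-assoc b m n)) (sym (+-suc b (m + n))))) r₂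
  refine {b = b} (slack {m = m} {n} m≤n p) le r
    with refine p (≤-trans (+-monoʳ-≤ b m≤n) le) r
  ... | σ₁ , run₁ , r₁ = σ₁ , slack (*-monoʳ-≤ (suc K) m≤n) run₁ , mono (+-monoʳ-≤ b m≤n) r₁

-- Function updates, finite tapes and iteration

T⇒true : ∀ {b} → T b → b ≡ true
T⇒true {true} _ = refl

upd : ∀ {A : Set} → (ℕ → A) → ℕ → A → ℕ → A
upd f k a j = if j ≡ᵇ k then a else f j

upd-same : ∀ {A : Set} (f : ℕ → A) k a → upd f k a k ≡ a
upd-same f k a = cong (λ z → if z then a else f k) (T⇒true (≡⇒≡ᵇ k k refl))

upd-other : ∀ {A : Set} (f : ℕ → A) k a {j} → j ≢ k → upd f k a j ≡ f j
upd-other f k a {j} j≢k with j ≡ᵇ k in e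
... | true  = contradiction (≡ᵇ⇒≡ j k (subst T (sym e) tt)) j≢k
... | false = refl

upd-id : ∀ {A : Set} (f : ℕ → A) k j → upd f k (f k) j ≡ f j
upd-id f k j with j ≡ᵇ k in e
... | true  = cong f (sym (≡ᵇ⇒≡ j k (subst T (sym e) tt)))
... | false = refl

upd-cong : ∀ {A : Set} (f g : ℕ → A) k {a b j} → a ≡ b → f j ≡ g j → upd f k a j ≡ upd g k b j
upd-cong f g k {j = j} refl e with j ≡ᵇ k
... | true  = refl
... | false = e

readV-writeV : ∀ {t} (w : Vec Bool t) i b {j} → j < t → readV (writeV w i b) j ≡ upd (readV w) i b j
readV-writeV []      i       b {j}     ()
readV-writeV (c ∷ w) zero    b {zero}  _       = refl
readV-writeV (c ∷ w) zero    b {suc j} _       = refl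
readV-writeV (c ∷ w) (suc i) b {zero}  _       = refl
readV-writeV (c ∷ w) (suc i) b {suc j} (s≤s l) = readV-writeV w i b l

readV-replicate : ∀ t j → readV (replicate t false) j ≡ false
readV-replicate zero    j       = refl
readV-replicate (suc t) zero    = refl
readV-replicate (suc t) (suc j) = readV-replicate t j

iter-shift : ∀ {A : Set} n (f : A → A) a → iter n f (f a) ≡ f (iter n f a)
iter-shift zero    f a = refl
iter-shift (suc n) f a = cong f (iter-shift n f a)

iter-fix : ∀ {A : Set} a (f : A → A) {z} → f z ≡ z → iter a f z ≡ z
iter-fix zero    f e = refl
iter-fix (suc a) f e = trans (cong f (iter-fix a f e)) e

-- One-tape machines with an unbounded work tape

TapeAct : Set → Set
TapeAct V = V → Maybe Bool → Bool → Bool → V × Bool × Move × Move × Move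

record Tape (V : Set) : Set where
  constructor mkTape
  field
    mem  : V
    inp  : ℕ
    bits : ℕ → Bool
    head : ℕ
    rnd  : ℕ

shift : Move → ℕ → ℕ
shift left  i = i ∸ 1
shift stay  i = i
shift right i = suc i

module _ {V : Set} (x : List Bool) where

  commit : Tape V → V × Bool × Move × Move × Move → Tape V
  commit (mkTape _ i w p r) (v , b , mi , mw , mr) =
    mkTape v (move mi (suc (length x)) i) (upd w p b) (shift mw p) (shift mr r)

  tapeModel : (ℕ → Bool) → Model V (TapeAct V)
  tapeModel ρ = record
    { S   = Tape V
    ; val = Tape.mem
    ; app = λ f s → commit s (f (Tape.mem s) (readIn x (Tape.inp s)) (Tape.bits s (Tape.head s)) (ρ (Tape.rnd s)))
    }

-- Control points of a program

Pos : ∀ {V A} → Prog V A → Set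
Pos (act a)     = ⊤
Pos (P ⨾ Q)     = Pos P ⊎ Pos Q
Pos (ite c P Q) = ⊤ ⊎ (Pos P ⊎ Pos Q)
Pos (while c P) = ⊤ ⊎ Pos P

entry : ∀ {V A} (P : Prog V A) → Pos P
entry (act a)     = tt
entry (P ⨾ Q)     = inj₁ (entry P)
entry (ite c P Q) = inj₁ tt
entry (while c P) = inj₁ tt

infixr 3 _⊎ᶠ_
infixr 4 _×ᶠ_

Finite : Set → Set
Finite A = Σ ℕ λ N → A ↔ Fin N

_⊎ᶠ_ : ∀ {A B} → Finite A → Finite B → Finite (A ⊎ B)
(m , f) ⊎ᶠ (n , g) = m + n , ↔-sym +↔⊎ ↔-∘ (f ⊎-↔ g)

_×ᶠ_ : ∀ {A B} → Finite A → Finite B → Finite (A × B)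
(m , f) ×ᶠ (n , g) = m * n , ↔-sym *↔× ↔-∘ (f ×-↔ g)

Boolᶠ : Finite Bool
Boolᶠ = 2 , ↔-sym 2↔Bool

⊤ᶠ : Finite ⊤
⊤ᶠ = 1 , ↔-sym 1↔⊤

Posᶠ : ∀ {V A} (P : Prog V A) → Finite (Pos P)
Posᶠ (act a)     = ⊤ᶠ
Posᶠ (P ⨾ Q)     = Posᶠ P ⊎ᶠ Posᶠ Q
Posᶠ (ite c P Q) = ⊤ᶠ ⊎ᶠ (Posᶠ P ⊎ᶠ Posᶠ Q)
Posᶠ (while c P) = ⊤ᶠ ⊎ᶠ Posᶠ P

continue : ∀ {P Q : Set} → (P → Q) → Q → Maybe P → Maybe Q
continue f e (just p) = just (f p)
continue f e nothing  = just e

module _ {V : Set} where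

  idle : V → Bool → V × Bool × Move × Move × Move
  idle v b = v , b , stay , stay , stay

  -- The answer `nothing` signals the exit from `P`; the enclosing program redirects it to its own
  -- next control point. A test takes a step of its own, which rewrites the scanned bit.
  next : (P : Prog V (TapeAct V)) → Pos P → V → Maybe Bool → Bool → Bool →
         Maybe (Pos P) × (V × Bool × Move × Move × Move)
  next (act f)     tt              v i w r = nothing , f v i w r
  next (P ⨾ Q)     (inj₁ p)        v i w r = map₁ (continue inj₁ (inj₂ (entry Q))) (next P p v i w r)
  next (P ⨾ Q)     (inj₂ q)        v i w r = map₁ (Maybe.map inj₂) (next Q q v i w r)
  next (ite c P Q) (inj₁ tt)       v i w r = just (inj₂ (if c v then inj₁ (entry P) else inj₂ (entry Q))) , idle v w
  next (ite c P Q) (inj₂ (inj₁ p)) v i w r = map₁ (Maybe.map (inj₂ ∘ inj₁)) (next P p v i w r)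
  next (ite c P Q) (inj₂ (inj₂ q)) v i w r = map₁ (Maybe.map (inj₂ ∘ inj₂)) (next Q q v i w r)
  next (while c P) (inj₁ tt)       v i w r = (if c v then just (inj₂ (entry P)) else nothing) , idle v w
  next (while c P) (inj₂ p)        v i w r = map₁ (continue inj₂ (inj₁ tt)) (next P p v i w r)

record FTape (V : Set) (t : ℕ) : Set where
  constructor mkFTape
  field
    mem  : V
    inp  : ℕ
    bits : Vec Bool t
    head : ℕ
    rnd  : ℕ

-- Execution of programs on finite tapes

module Steps {V : Set} (x : List Bool) {t : ℕ} (r : Vec Bool t) where

  commitF : FTape V t → V × Bool × Move × Move × Move → FTape V t
  commitF (mkFTape _ i w p q) (v , b , mi , mw , mr) =
    mkFTape v (move mi (suc (length x)) i) (writeV w p b) (move mw (t ∸ 1) p) (move mr (t ∸ 1) q)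

  nextF : (P : Prog V (TapeAct V)) → Pos P → FTape V t → Maybe (Pos P) × (V × Bool × Move × Move × Move)
  nextF P p (mkFTape v i w wi ri) = next P p v (readIn x i) (readV w wi) (readV r ri)

  -- Execution of the compiled program up to its exit, with the exact number of steps.
  data _⊢_,_⟶[_]_ (P : Prog V (TapeAct V)) (p : Pos P) (c : FTape V t) : ℕ → FTape V t → Set where
    last : proj₁ (nextF P p c) ≡ nothing → P ⊢ p , c ⟶[ 1 ] commitF c (proj₂ (nextF P p c))
    more : ∀ {p′ m c′} → proj₁ (nextF P p c) ≡ just p′ →
           P ⊢ p′ , commitF c (proj₂ (nextF P p c)) ⟶[ m ] c′ → P ⊢ p , c ⟶[ suc m ] c′

  seqˡ : ∀ {P Q p c m c′ n c″} → P ⊢ p , c ⟶[ m ] c′ → Q ⊢ entry Q , c′ ⟶[ n ] c″ →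
         (P ⨾ Q) ⊢ inj₁ p , c ⟶[ m + n ] c″
  seqʳ : ∀ {P Q q c m c′} → Q ⊢ q , c ⟶[ m ] c′ → (P ⨾ Q) ⊢ inj₂ q , c ⟶[ m ] c′
  seqʳ (last e)   = last (cong (Maybe.map inj₂) e)
  seqʳ (more e s) = more (cong (Maybe.map inj₂) e) (seqʳ s)
  seqˡ {P} {Q} (last e)   s′ = more (cong (continue inj₁ (inj₂ (entry Q))) e) (seqʳ s′)
  seqˡ {P} {Q} (more e s) s′ = more (cong (continue inj₁ (inj₂ (entry Q))) e) (seqˡ s s′)

  iteˡ : ∀ {b P Q p c m c′} → P ⊢ p , c ⟶[ m ] c′ → ite b P Q ⊢ inj₂ (inj₁ p) , c ⟶[ m ] c′
  iteˡ (last e)   = last (cong (Maybe.map (inj₂ ∘ inj₁)) e)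
  iteˡ (more e s) = more (cong (Maybe.map (inj₂ ∘ inj₁)) e) (iteˡ s)

  iteʳ : ∀ {b P Q q c m c′} → Q ⊢ q , c ⟶[ m ] c′ → ite b P Q ⊢ inj₂ (inj₂ q) , c ⟶[ m ] c′
  iteʳ (last e)   = last (cong (Maybe.map (inj₂ ∘ inj₂)) e)
  iteʳ (more e s) = more (cong (Maybe.map (inj₂ ∘ inj₂)) e) (iteʳ s)

  whileBody : ∀ {b P p c m c′ n c″} → P ⊢ p , c ⟶[ m ] c′ → while b P ⊢ inj₁ tt , c′ ⟶[ n ] c″ →
              while b P ⊢ inj₂ p , c ⟶[ m + n ] c″
  whileBody (last e)   s′ = more (cong (continue inj₂ (inj₁ tt)) e) s′
  whileBody (more e s) s′ = more (cong (continue inj₂ (inj₁ tt)) e) (whileBody s s′)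

  -- b bounds the number of steps made so far; as long as it stays below t the
  -- heads do not reach the end of the finite tapes.
  record Agree (b : ℕ) (c : FTape V t) (s : Tape V) : Set where
    constructor agree
    field
      mem≡  : FTape.mem c ≡ Tape.mem s
      inp≡  : FTape.inp c ≡ Tape.inp s
      bits≡ : ∀ {j} → j < t → readV (FTape.bits c) j ≡ Tape.bits s j
      head≡ : FTape.head c ≡ Tape.head s
      rnd≡  : FTape.rnd c ≡ Tape.rnd s
      head≤ : Tape.head s ≤ b
      rnd≤  : Tape.rnd s ≤ b

  move-shift : ∀ d {b p} → p ≤ b → suc b < t → move d (t ∸ 1) p ≡ shift d p
  move-shift left  l m = refl
  move-shift stay  l m = refl
  move-shift right {b} {p} l m = cong (λ z → if z then suc p else p)
    (T⇒true (≤⇒≤ᵇ (∸-monoˡ-≤ 1 (≤-trans (s≤s (s≤s l)) m))))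

  shift-bound : ∀ d {b p} → p ≤ b → shift d p ≤ suc b
  shift-bound left  {b} {p} l = ≤-trans (m∸n≤m p 1) (≤-trans l (n≤1+n b))
  shift-bound stay  l = ≤-trans l (n≤1+n _)
  shift-bound right l = s≤s l

  agree-commit : ∀ {b c s} a → suc b < t → Agree b c s → Agree (suc b) (commitF c a) (commit x s a)
  agree-commit {c = mkFTape _ _ w p _} {s} (v , bit , mi , mw , mr) lt (agree refl refl w≡ refl refl hl rl) =
    agree refl refl (λ l → trans (readV-writeV w p bit l) (upd-cong (readV w) (Tape.bits s) p refl (w≡ l)))
      (move-shift mw hl lt) (move-shift mr rl lt) (shift-bound mw hl) (shift-bound mr rl)

  -- A test costs the machine a step while the state of the model stays the same, so writing back
  -- the scanned bit must be seen to change nothing.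
  agree-idle : ∀ {b c s} → suc b < t → Agree b c s →
               Agree (suc b) (commitF c (idle (FTape.mem c) (readV (FTape.bits c) (FTape.head c)))) s
  agree-idle {b} {mkFTape _ _ w p _} lt (agree refl refl w≡ refl refl hl rl) =
    agree refl refl
      (λ {j} l → trans (readV-writeV w p _ l) (trans (upd-id (readV w) p j) (w≡ l)))
      refl refl (≤-trans hl (n≤1+n b)) (≤-trans rl (n≤1+n b))

  agree-mono : ∀ {b b′ c s} → b ≤ b′ → Agree b c s → Agree b′ c s
  agree-mono l (agree e₁ e₂ e₃ e₄ e₅ hl rl) = agree e₁ e₂ e₃ e₄ e₅ (≤-trans hl l) (≤-trans rl l)

  -- `Run` only bounds the time, so the exact number of steps `m′` has to be produced. The head
  -- bounds are carried along with the larger `b + m`; below `t` they keep both heads on cells that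
  -- exist.
  run⇒steps : ∀ {P s m s′ b c} → Run (tapeModel x (readV r)) P s m s′ → b + m < t → Agree b c s →
              Σ ℕ λ m′ → Σ (FTape V t) λ c′ →
                m′ ≤ m × P ⊢ entry P , c ⟶[ m′ ] c′ × Agree (b + m) c′ s′
  run⇒steps {s = s} {b = b} {c} (act {f}) lt ag =
    1 , _ , ≤-refl , last refl ,
    subst (λ a → Agree (b + 1) (commitF c (same c)) (commit x s a)) (action≡ ag)
      (agree-mono (≤-reflexive (+-comm 1 b)) (agree-commit (same c) (subst (_< t) (+-comm b 1) lt) ag))
    where
    same : FTape V t → V × Bool × Move × Move × Move
    same d = f (FTape.mem d) (readIn x (FTape.inp d)) (readV (FTape.bits d) (FTape.head d)) (readV r (FTape.rnd d))
    b<t : b < t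
    b<t = ≤-trans (s≤s (m≤m+n b 1)) lt
    action≡ : Agree b c s → same c ≡ f (Tape.mem s) (readIn x (Tape.inp s)) (Tape.bits s (Tape.head s)) (readV r (Tape.rnd s))
    action≡ (agree refl refl w≡ refl refl hl rl) =
      cong (λ z → f (Tape.mem s) (readIn x (Tape.inp s)) z (readV r (Tape.rnd s))) (w≡ (≤-trans (s≤s hl) b<t))
  run⇒steps {b = b} (seq {m = m} {n} p q) lt ag
    with run⇒steps p (≤-trans (s≤s (+-monoʳ-≤ b (m≤m+n m n))) lt) ag
  ... | m₁ , c₁ , l₁ , s₁ , ag₁ with run⇒steps q (subst (_< t) (sym (+-assoc b m n)) lt) ag₁
  ... | m₂ , c₂ , l₂ , s₂ , ag₂ =
    m₁ + m₂ , c₂ , +-mono-≤ l₁ l₂ , seqˡ s₁ s₂ , agree-mono (≤-reflexive (+-assoc b m n)) ag₂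
  run⇒steps {b = b} (ite-true {d} {P} {Q} {m = m} e p) lt ag
    with run⇒steps p (subst (_< t) (+-suc b m) lt)
           (agree-idle (≤-trans (s≤s (≤-trans (≤-reflexive (+-comm 1 b)) (+-monoʳ-≤ b (s≤s z≤n)))) lt) ag)
  ... | m₁ , c₁ , l₁ , s₁ , ag₁ =
    suc m₁ , c₁ , s≤s l₁
    , more (cong (λ z → just (inj₂ (if z then inj₁ (entry P) else inj₂ (entry Q)))) (trans (cong d (Agree.mem≡ ag)) e)) (iteˡ s₁)
    , agree-mono (≤-reflexive (sym (+-suc b m))) ag₁
  run⇒steps {b = b} (ite-false {d} {P} {Q} {m = m} e p) lt ag
    with run⇒steps p (subst (_< t) (+-suc b m) lt)
           (agree-idle (≤-trans (s≤s (≤-trans (≤-reflexive (+-comm 1 b)) (+-monoʳ-≤ b (s≤s z≤n)))) lt) ag)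
  ... | m₁ , c₁ , l₁ , s₁ , ag₁ =
    suc m₁ , c₁ , s≤s l₁
    , more (cong (λ z → just (inj₂ (if z then inj₁ (entry P) else inj₂ (entry Q)))) (trans (cong d (Agree.mem≡ ag)) e)) (iteʳ s₁)
    , agree-mono (≤-reflexive (sym (+-suc b m))) ag₁
  run⇒steps {b = b} (while-false {d} {P} e) lt ag =
    1 , _ , ≤-refl , last (cong (λ z → if z then just (inj₂ (entry P)) else nothing) (trans (cong d (Agree.mem≡ ag)) e))
    , agree-mono (≤-reflexive (+-comm 1 b)) (agree-idle (subst (_< t) (+-comm b 1) lt) ag)
  run⇒steps {b = b} (while-true {d} {P} {m = m} {n} e p q) lt ag
    with run⇒steps p (≤-trans (s≤s (≤-trans (≤-reflexive (sym (+-suc b m))) (+-monoʳ-≤ b (s≤s (m≤m+n m n))))) lt)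
           (agree-idle (≤-trans (s≤s (≤-trans (≤-reflexive (+-comm 1 b)) (+-monoʳ-≤ b (s≤s z≤n)))) lt) ag)
  ... | m₁ , c₁ , l₁ , s₁ , ag₁
    with run⇒steps q (subst (_< t) (trans (+-suc b (m + n)) (cong suc (sym (+-assoc b m n)))) lt) ag₁
  ... | m₂ , c₂ , l₂ , s₂ , ag₂ =
    suc (m₁ + m₂) , c₂ , s≤s (+-mono-≤ l₁ l₂)
    , more (cong (λ z → if z then just (inj₂ (entry P)) else nothing) (trans (cong d (Agree.mem≡ ag)) e)) (whileBody s₁ s₂)
    , agree-mono (≤-reflexive (trans (cong suc (+-assoc b m n)) (sym (+-suc b (m + n))))) ag₂
  run⇒steps {b = b} (slack m≤n p) lt ag
    with run⇒steps p (≤-trans (s≤s (+-monoʳ-≤ b m≤n)) lt) ag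
  ... | m₁ , c₁ , l₁ , s₁ , ag₁ = m₁ , c₁ , ≤-trans l₁ m≤n , s₁ , agree-mono (+-monoʳ-≤ b m≤n) ag₁

-- The probabilistic machine of a program

Control : ∀ {V A} → Prog V A → Set
Control {V} P = (Pos P × V) ⊎ Bool

module Machine {V : Set} (P : Prog V (TapeAct V)) (v₀ : V) (out : V → Bool)
               (Controlᶠ : Finite (Control P)) where

  N : ℕ
  N = proj₁ Controlᶠ

  enc : Control P → Fin N
  enc = Inverse.to (proj₂ Controlᶠ)

  dec : Fin N → Control P
  dec = Inverse.from (proj₂ Controlᶠ)

  dec-enc : ∀ s → dec (enc s) ≡ s
  dec-enc s = Inverse.strictlyInverseʳ (proj₂ Controlᶠ) s

  target : Maybe (Pos P) → V → Control P
  target (just p) v = inj₁ (p , v)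
  target nothing  v = inj₂ (out v)

  haltC : Control P → Maybe Bool
  haltC (inj₁ _) = nothing
  haltC (inj₂ b) = just b

  emit : Maybe (Pos P) × (V × Bool × Move × Move × Move) → Fin N × Bool × Move × Move × Move
  emit (p , v , b , ms) = enc (target p v) , b , ms

  δC : Control P → Maybe Bool → Bool → Bool → Fin N × Bool × Move × Move × Move
  δC (inj₁ (p , v)) i w r = emit (next P p v i w r)
  δC (inj₂ b)       i w r = enc (inj₂ b) , w , stay , stay , stay

  machine : ProbMachine
  machine = record
    { Q     = N
    ; start = enc (inj₁ (entry P , v₀))
    ; halt  = haltC ∘ dec
    ; δ     = δC ∘ dec
    }

  module _ (x : List Bool) {t : ℕ} (r : Vec Bool t) where
    open Steps {V} x r

    conf : Control P → FTape V t → ProbConfig t N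
    conf s (mkFTape _ i w p q) = pcfg (enc s) i w p q

    step-run : ∀ p c → probStep machine x r (conf (inj₁ (p , FTape.mem c)) c) ≡
               conf (target (proj₁ (nextF P p c)) (FTape.mem (commitF c (proj₂ (nextF P p c)))))
                    (commitF c (proj₂ (nextF P p c)))
    step-run p (mkFTape v i w wi ri) rewrite dec-enc (inj₁ (p , v)) | dec-enc (inj₁ (p , v)) = refl

    step-halt : ∀ b c → probStep machine x r (conf (inj₂ b) c) ≡ conf (inj₂ b) c
    step-halt b (mkFTape v i w wi ri) rewrite dec-enc (inj₂ b) = refl

    -- The output is read off after a prescribed number of steps; the surplus `n` steps are spent in
    -- the absorbing halting state.
    iter-steps : ∀ {p c m c′} n → P ⊢ p , c ⟶[ m ] c′ →
                 iter (m + n) (probStep machine x r) (conf (inj₁ (p , FTape.mem c)) c) ≡ conf (inj₂ (out (FTape.mem c′))) c′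
    iter-steps {p} {c} n (last e)
      rewrite sym (iter-shift n (probStep machine x r) (conf (inj₁ (p , FTape.mem c)) c))
            | step-run p c | e =
      iter-fix n (probStep machine x r) (step-halt _ (commitF c (proj₂ (nextF P p c))))
    iter-steps {p} {c} n (more {m = m} e s)
      rewrite sym (iter-shift (m + n) (probStep machine x r) (conf (inj₁ (p , FTape.mem c)) c))
            | step-run p c | e = iter-steps n s

    initial : Tape V
    initial = mkTape v₀ 0 (λ _ → false) 0 0

    probOutput-run : ∀ {m s′} → Run (tapeModel x (readV r)) P initial m s′ → m < t →
                     probOutput machine x t r ≡ just (out (Tape.mem s′))
    probOutput-run {s′ = s′} run lt
      with run⇒steps {c = mkFTape v₀ 0 (replicate t false) 0 0} run lt
             (agree refl refl (λ {j} _ → readV-replicate t j) refl refl z≤n z≤n)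
    ... | m′ , c′ , l , s , ag = begin
      haltC (dec (ProbConfig.state (iter t step c₀)))
        ≡⟨ cong (λ k → haltC (dec (ProbConfig.state (iter k step c₀)))) (m+[n∸m]≡n (≤-trans l (<⇒≤ lt))) ⟨
      haltC (dec (ProbConfig.state (iter (m′ + (t ∸ m′)) step c₀)))
        ≡⟨ cong (haltC ∘ dec ∘ ProbConfig.state) (iter-steps (t ∸ m′) s) ⟩
      haltC (dec (enc (inj₂ (out (FTape.mem c′)))))
        ≡⟨ cong haltC (dec-enc (inj₂ (out (FTape.mem c′)))) ⟩
      just (out (FTape.mem c′))
        ≡⟨ cong (just ∘ out) (Agree.mem≡ ag) ⟩
      just (out (Tape.mem s′)) ∎
      where
      open ≡-Reasoning
      step = probStep machine x r
      c₀ = conf (inj₁ (entry P , v₀)) (mkFTape v₀ 0 (replicate t false) 0 0)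

readV-ext : ∀ {t} (u w : Vec Bool t) → (∀ {j} → j < t → readV u j ≡ readV w j) → u ≡ w
readV-ext []      []      e = refl
readV-ext (a ∷ u) (b ∷ w) e = cong₂ _∷_ (e (s≤s z≤n)) (readV-ext u w (λ l → e (s≤s l)))

-- Machines whose tape cells hold B bits; the random head follows the work head

CellAct : Set → ℕ → Set
CellAct V B = V → Maybe Bool → Vec Bool B → Bool → V × Vec Bool B × Move × Move

record CellTape (V : Set) (B : ℕ) : Set where
  constructor mkCells
  field
    mem   : V
    inp   : ℕ
    cells : ℕ → Vec Bool B
    pos   : ℕ

commitC : ∀ {V B} → List Bool → CellTape V B → V × Vec Bool B × Move × Move → CellTape V B
commitC x (mkCells _ i w p) (v , c , mi , mp) =
  mkCells v (move mi (suc (length x)) i) (upd w p c) (shift mp p)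

-- Cell `p` and random bit `p` are always scanned together. This is what later allows a catalytic
-- bit to be stored as its difference from the random bit with the same address.
cellModel : ∀ {V B} → List Bool → (ℕ → Bool) → Model V (CellAct V B)
cellModel {V} {B} x ρ = record
  { S   = CellTape V B
  ; val = CellTape.mem
  ; app = λ f s → commitC x s (f (CellTape.mem s) (readIn x (CellTape.inp s))
                                 (CellTape.cells s (CellTape.pos s)) (ρ (CellTape.pos s)))
  }

-- Wide cells as blocks of bits

module Blocks {V : Set} {B : ℕ} where

  W : Set
  W = V × Vec Bool B × Move

  nop : Prog W (TapeAct W)
  nop = act λ v i b r → v , b , stay , stay , stay

  readBlock : ℕ → Prog W (TapeAct W)
  readBlock zero    = nop
  readBlock (suc m) =
    readBlock m ⨾ act λ (v , buf , d) i b r → (v , writeV buf m b , d) , b , stay , right , stay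

  -- Writing from the last bit to the first brings the head back to the start of the block, where
  -- `readBlock` began.
  writeBlock : ℕ → Prog W (TapeAct W)
  writeBlock zero    = nop
  writeBlock (suc m) =
    act (λ v i b r → v , b , stay , left , stay) ⨾
    act (λ (v , buf , d) i b r → (v , buf , d) , readV buf m , stay , stay , stay) ⨾
    writeBlock m

  moveBlock : ℕ → Prog W (TapeAct W)
  moveBlock zero    = nop
  moveBlock (suc m) = act (λ (v , buf , d) i b r → (v , buf , d) , b , stay , d , stay) ⨾ moveBlock m

  -- The random head moves here, once per cell. The work head makes the same move `B` times later,
  -- so the move is kept in the memory.
  update : CellAct V B → TapeAct W
  update f (v , buf , _) i b r =
    let (v′ , c , mi , mp) = f v i buf r in (v′ , c , mp) , b , mi , stay , mp

  blockCode : CellAct V B → Prog W (TapeAct W)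
  blockCode f = readBlock B ⨾ act (update f) ⨾ writeBlock B ⨾ moveBlock B

  blockCost : ℕ
  blockCost = suc B + (1 + (suc (B + B) + suc B))

  shiftBy : Move → ℕ → ℕ → ℕ
  shiftBy d zero    h = h
  shiftBy d (suc m) h = shiftBy d m (shift d h)

  -- For left moves this is distributivity of multiplication over truncated subtraction: `B` left
  -- moves from cell `0` stay there, just as one move of a wide cell does.
  shiftBy-block : ∀ d p → shiftBy d B (p * B) ≡ shift d p * B
  shiftBy-block left p = trans (go B (p * B)) (trans (cong (p * B ∸_) (sym (*-identityˡ B))) (sym (*-distribʳ-∸ B p 1)))
    where
    go : ∀ m h → shiftBy left m h ≡ h ∸ m
    go zero    h = refl
    go (suc m) h = trans (go m (h ∸ 1)) (∸-+-assoc h 1 m)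
  shiftBy-block stay p = go B (p * B)
    where
    go : ∀ m h → shiftBy stay m h ≡ h
    go zero    h = refl
    go (suc m) h = go m h
  shiftBy-block right p = go B (p * B)
    where
    go : ∀ m h → shiftBy right m h ≡ m + h
    go zero    h = refl
    go (suc m) h = trans (go m (suc h)) (+-suc m h)

  module _ (x : List Bool) (ρ : ℕ → Bool) where

    𝓣 : Model W (TapeAct W)
    𝓣 = tapeModel x ρ

    -- Each step rewrites the bit it scans, so the tape afterwards is a different function with the
    -- same values; hence the pointwise equality.
    readBlock-run : ∀ m → m ≤ B → ∀ v buf d i w h r →
      Σ (Vec Bool B) λ buf′ → Σ (ℕ → Bool) λ w′ →
        Run 𝓣 (readBlock m) (mkTape (v , buf , d) i w h r) (suc m) (mkTape (v , buf′ , d) i w′ (m + h) r)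
        × (∀ j → w′ j ≡ w j) × (∀ {j} → j < m → readV buf′ j ≡ w (j + h))
    readBlock-run zero    l v buf d i w h r = buf , _ , act , upd-id w h , λ ()
    readBlock-run (suc m) l v buf d i w h r with readBlock-run m (≤-trans (n≤1+n m) l) v buf d i w h r
    ... | buf′ , w′ , run , same , got =
      _ , _ , slack (≤-reflexive (+-comm (suc m) 1)) (seq run act)
      , (λ j → trans (upd-id w′ (m + h) j) (same j)) , got′
      where
      got′ : ∀ {j} → j < suc m → readV (writeV buf′ m (w′ (m + h))) j ≡ w (j + h)
      got′ {j} (s≤s j≤m) with m≤n⇒m<n∨m≡n j≤m
      ... | inj₁ j<m  = trans (readV-writeV buf′ m _ (≤-trans (s≤s j≤m) l))
                          (trans (upd-other (readV buf′) m _ (<⇒≢ j<m)) (got j<m))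
      ... | inj₂ refl = trans (readV-writeV buf′ m _ l) (trans (upd-same (readV buf′) m _) (same (m + h)))

    writeBlock-run : ∀ m v buf d i w h r →
      Σ (ℕ → Bool) λ w′ →
        Run 𝓣 (writeBlock m) (mkTape (v , buf , d) i w (m + h) r) (suc (m + m)) (mkTape (v , buf , d) i w′ h r)
        × (∀ {j} → j < m → w′ (j + h) ≡ readV buf j)
        × (∀ {k} → k < h ⊎ m + h ≤ k → w′ k ≡ w k)
    writeBlock-run zero    v buf d i w h r = _ , act , (λ ()) , λ {k} _ → upd-id w h k
    writeBlock-run (suc m) v buf d i w h r with writeBlock-run m v buf d i _ h r
    ... | w′ , run , put , same =
      w′ , slack (≤-reflexive (cong (λ z → suc (suc z)) (sym (+-suc m m)))) (seq act (seq act run)) , put′ , same′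
      where
      w₁ = upd w (suc m + h) (w (suc m + h))
      put′ : ∀ {j} → j < suc m → w′ (j + h) ≡ readV buf j
      put′ {j} (s≤s j≤m) with m≤n⇒m<n∨m≡n j≤m
      ... | inj₁ j<m  = put j<m
      ... | inj₂ refl = trans (same (inj₂ ≤-refl)) (upd-same w₁ (m + h) (readV buf m))
      outside : ∀ {k} → k < h ⊎ suc m + h ≤ k → k ≢ m + h
      outside (inj₁ k<h) refl = <⇒≱ k<h (m≤n+m h m)
      outside (inj₂ m<k) refl = 1+n≰n m<k
      weaken : ∀ {k} → k < h ⊎ suc m + h ≤ k → k < h ⊎ m + h ≤ k
      weaken (inj₁ l) = inj₁ l
      weaken (inj₂ l) = inj₂ (<⇒≤ l)
      same′ : ∀ {k} → k < h ⊎ suc m + h ≤ k → w′ k ≡ w k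
      same′ {k} o = trans (same (weaken o)) (trans (upd-other w₁ (m + h) (readV buf m) (outside o)) (upd-id w (suc m + h) k))

    moveBlock-run : ∀ m v buf d i w h r →
      Σ (ℕ → Bool) λ w′ →
        Run 𝓣 (moveBlock m) (mkTape (v , buf , d) i w h r) (suc m) (mkTape (v , buf , d) i w′ (shiftBy d m h) r)
        × (∀ j → w′ j ≡ w j)
    moveBlock-run zero    v buf d i w h r = _ , act , upd-id w h
    moveBlock-run (suc m) v buf d i w h r with moveBlock-run m v buf d i (upd w h (w h)) (shift d h) r
    ... | w′ , run , same = w′ , seq act run , λ j → trans (same j) (upd-id w h j)

    record Layout (σ : Tape W) (s : CellTape V B) : Set where
      constructor layout
      field
        mem≡  : proj₁ (Tape.mem σ) ≡ CellTape.mem s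
        inp≡  : Tape.inp σ ≡ CellTape.inp s
        head≡ : Tape.head σ ≡ CellTape.pos s * B
        rnd≡  : Tape.rnd σ ≡ CellTape.pos s
        bits≡ : ∀ q {j} → j < B → Tape.bits σ (j + q * B) ≡ readV (CellTape.cells s q) j

    other-block : ∀ p q → q ≢ p → ∀ {j} → j < B → j + q * B < p * B ⊎ B + p * B ≤ j + q * B
    other-block p q q≢p {j} j<B with ≤-total p q
    ... | inj₁ p≤q = inj₂ (≤-trans (*-monoˡ-≤ B (≤∧≢⇒< p≤q (λ e → q≢p (sym e)))) (m≤n+m (q * B) j))
    ... | inj₂ q≤p = inj₁ (≤-trans (+-monoˡ-≤ (q * B) j<B) (*-monoˡ-≤ B (≤∧≢⇒< q≤p q≢p)))

    blockSim : ∀ f {σ s} → Layout σ s →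
               Σ (Tape W) λ σ′ → Run 𝓣 (blockCode f) σ blockCost σ′ × Layout σ′ (Model.app (cellModel x ρ) f s)
    blockSim f {mkTape (v , buf , d) i w h r} {mkCells _ _ cells p} (layout refl refl refl refl bits≡)
      with readBlock-run B ≤-refl v buf d i w (p * B) p
    ... | buf₁ , w₁ , run₁ , same₁ , got
      with readV-ext buf₁ (cells p) (λ l → trans (got l) (bits≡ p l))
    ... | refl = _ , seq run₁ (seq act (seq run₂ run₃)) , layout refl refl (shiftBy-block mp p) refl bits′
      where
      v′ = proj₁ (f v (readIn x i) (cells p) (ρ p))
      c′ = proj₁ (proj₂ (f v (readIn x i) (cells p) (ρ p)))
      mi = proj₁ (proj₂ (proj₂ (f v (readIn x i) (cells p) (ρ p))))
      mp = proj₂ (proj₂ (proj₂ (f v (readIn x i) (cells p) (ρ p))))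
      i′ = move mi (suc (length x)) i
      w₂ = upd w₁ (B + p * B) (w₁ (B + p * B))
      R₂ = writeBlock-run B v′ c′ mp i′ w₂ (p * B) (shift mp p)
      w₃ = proj₁ R₂
      run₂ = proj₁ (proj₂ R₂)
      R₃ = moveBlock-run B v′ c′ mp i′ w₃ (p * B) (shift mp p)
      w₄ = proj₁ R₃
      run₃ = proj₁ (proj₂ R₃)
      bits′ : ∀ q {j} → j < B → w₄ (j + q * B) ≡ readV (upd cells p c′ q) j
      bits′ q {j} l with q ≟ p
      ... | yes refl = trans (proj₂ (proj₂ R₃) _) (trans (proj₁ (proj₂ (proj₂ R₂)) l)
                         (cong (λ z → readV z j) (sym (upd-same cells p c′))))
      ... | no q≢p   = trans (proj₂ (proj₂ R₃) _) (trans (proj₂ (proj₂ (proj₂ R₂)) (other-block p q q≢p l))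
                         (trans (upd-id w₁ (B + p * B) _) (trans (same₁ _) (trans (bits≡ q l)
                           (cong (λ z → readV z j) (sym (upd-other cells p c′ q≢p)))))))

    blockRefines : ∀ N → Refines 𝓣 (cellModel x ρ) N blockCost
    blockRefines N = record
      { h = proj₁ ; code = blockCode ; R = λ _ → Layout
      ; val≡ = Layout.mem≡ ; mono = λ _ r → r ; sim = λ f _ → blockSim f }

<ᵇ-true : ∀ {m n} → m < n → (m <ᵇ n) ≡ true
<ᵇ-true l = T⇒true (<⇒<ᵇ l)

<ᵇ-irrefl : ∀ n → (n <ᵇ n) ≡ false
<ᵇ-irrefl zero    = refl
<ᵇ-irrefl (suc n) = <ᵇ-irrefl n

-- Meant for unary tracks: incrementing a register with value `n` changes its track in cell `n`
-- only. `<ᵇ-pred` is the counterpart for decrements, with cell `pred n`.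
<ᵇ-sucʳ : ∀ q n → q ≢ n → (q <ᵇ suc n) ≡ (q <ᵇ n)
<ᵇ-sucʳ zero    zero    ne = contradiction refl ne
<ᵇ-sucʳ zero    (suc n) ne = refl
<ᵇ-sucʳ (suc q) zero    ne = refl
<ᵇ-sucʳ (suc q) (suc n) ne = <ᵇ-sucʳ q n (λ e → ne (cong suc e))

<ᵇ-pred : ∀ q n → q ≢ pred n → (q <ᵇ pred n) ≡ (q <ᵇ n)
<ᵇ-pred q zero    ne = refl
<ᵇ-pred q (suc n) ne = sym (<ᵇ-sucʳ q n ne)

-- Register machines with two bit arrays addressed by registers

data RegAct (V : Set) (R : ℕ) : Set where
  ctl  : (V → Maybe Bool → Vec Bool R → V × Move) → RegAct V R
  look : Fin R → (V → Maybe Bool → Bool → Bool → Bool → Vec Bool R → V × Bool × Bool × Move) → RegAct V R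
  inc  : Fin R → RegAct V R
  dec  : Fin R → RegAct V R

record RegState (V : Set) (R : ℕ) : Set where
  constructor mkRegs
  field
    mem  : V
    inp  : ℕ
    regs : Vec ℕ R
    arr₁ : ℕ → Bool
    arr₂ : ℕ → Bool

commitR : ∀ {V R} → List Bool → Fin R → RegState V R → V × Bool × Bool × Move → RegState V R
commitR x a (mkRegs _ i rs u w) (v , b , c , mi) =
  mkRegs v (move mi (suc (length x)) i) rs (upd u (lookup rs a) b) (upd w (lookup rs a) c)

-- The tests supplied to `ctl` and `look` are what one cell of the unary encoding shows: cell `0`
-- tells which registers are nonzero, and cell `p` which registers exceed `p`. They therefore cost
-- nothing extra.
regApp : ∀ {V R} → List Bool → (ℕ → Bool) → RegAct V R → RegState V R → RegState V R
regApp x ρ (ctl f) (mkRegs v i rs u w) =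
  let (v′ , mi) = f v (readIn x i) (map (0 <ᵇ_) rs) in mkRegs v′ (move mi (suc (length x)) i) rs u w
regApp x ρ (look a f) s@(mkRegs v i rs u w) = let p = lookup rs a in
  commitR x a s (f v (readIn x i) (ρ p) (u p) (w p) (map (p <ᵇ_) rs))
regApp x ρ (inc r) (mkRegs v i rs u w) = mkRegs v i (updateAt rs r suc) u w
regApp x ρ (dec r) (mkRegs v i rs u w) = mkRegs v i (updateAt rs r pred) u w

regModel : ∀ {V R} → List Bool → (ℕ → Bool) → Model V (RegAct V R)
regModel {V} {R} x ρ = record { S = RegState V R ; val = RegState.mem ; app = regApp x ρ }

map-updateAt-set : ∀ {R} (rs : Vec ℕ R) r f q {b} → (q <ᵇ f (lookup rs r)) ≡ b →
                   map (q <ᵇ_) rs [ r ]≔ b ≡ map (q <ᵇ_) (updateAt rs r f)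
map-updateAt-set (a ∷ rs) Fin.zero    f q e = cong (_∷ _) (sym e)
map-updateAt-set (a ∷ rs) (Fin.suc r) f q e = cong (_ ∷_) (map-updateAt-set rs r f q e)

map-updateAt-same : ∀ {R} (rs : Vec ℕ R) r f q → (q <ᵇ f (lookup rs r)) ≡ (q <ᵇ lookup rs r) →
                    map (q <ᵇ_) (updateAt rs r f) ≡ map (q <ᵇ_) rs
map-updateAt-same (a ∷ rs) Fin.zero    f q e = cong (_∷ map (q <ᵇ_) rs) e
map-updateAt-same (a ∷ rs) (Fin.suc r) f q e = cong (_ ∷_) (map-updateAt-same rs r f q e)

updateAt-bound : ∀ {R} (rs : Vec ℕ R) r (f : ℕ → ℕ) {b b′} → b ≤ b′ → (∀ {a} → a ≤ b → f a ≤ b′) →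
                 (∀ j → lookup rs j ≤ b) → ∀ j → lookup (updateAt rs r f) j ≤ b′
updateAt-bound (a ∷ rs) Fin.zero    f l g h Fin.zero    = g (h Fin.zero)
updateAt-bound (a ∷ rs) Fin.zero    f l g h (Fin.suc j) = ≤-trans (h (Fin.suc j)) l
updateAt-bound (a ∷ rs) (Fin.suc r) f l g h Fin.zero    = ≤-trans (h Fin.zero) l
updateAt-bound (a ∷ rs) (Fin.suc r) f l g h (Fin.suc j) = updateAt-bound rs r f l g (λ k → h (Fin.suc k)) j

-- Registers are stored in unary, one track each, next to a track marking cell 0
-- and one track for each array.

encode : ∀ {R} → Vec ℕ R → (ℕ → Bool) → (ℕ → Bool) → ℕ → Vec Bool (3 + R)
encode rs u w q = (q <ᵇ 1) ∷ u q ∷ w q ∷ map (q <ᵇ_) rs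

-- Register instructions on parallel tracks

module Tracks {V : Set} {R : ℕ} where

  W : Set
  W = V × Bool

  CellProg : Set
  CellProg = Prog W (CellAct W (3 + R))

  peek : (Vec Bool (3 + R) → Bool) → CellProg
  peek f = act λ (v , _) i c r → (v , f c) , c , stay , stay

  go : Move → CellProg
  go d = act λ v i c r → v , c , stay , d

  set : Fin R → Bool → CellProg
  set r b = act λ { v i (o ∷ u ∷ w ∷ rs) _ → v , (o ∷ u ∷ w ∷ rs [ r ]≔ b) , stay , stay }

  isSet : Fin R → Vec Bool (3 + R) → Bool
  isSet r (_ ∷ _ ∷ _ ∷ rs) = lookup rs r

  notOrigin : Vec Bool (3 + R) → Bool
  notOrigin (o ∷ _) = not o

  -- The track of `r` is set exactly in the cells before the value of `r`, so the first unset cell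
  -- is the one that `r` addresses.
  seekReg : Fin R → CellProg
  seekReg r = peek (isSet r) ⨾ while proj₂ (go right ⨾ peek (isSet r))

  home : CellProg
  home = peek notOrigin ⨾ while proj₂ (go left ⨾ peek notOrigin)

  local : (V → Maybe Bool → Bool → Bool → Bool → Vec Bool R → V × Bool × Bool × Move) → CellProg
  local f = act λ { (v , b) i (o ∷ u ∷ w ∷ rs) r →
    let (v′ , u′ , w′ , mi) = f v i r u w rs in (v′ , b) , (o ∷ u′ ∷ w′ ∷ rs) , mi , stay }

  regCode : RegAct V R → CellProg
  regCode (ctl f)    = act λ { (v , b) i (o ∷ u ∷ w ∷ rs) r →
    let (v′ , mi) = f v i rs in (v′ , b) , (o ∷ u ∷ w ∷ rs) , mi , stay }
  regCode (look a f) = seekReg a ⨾ local f ⨾ home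
  regCode (inc r)    = seekReg r ⨾ set r true ⨾ home
  -- The last set cell is one to the left. For value zero the head stays in cell `0`, where the
  -- track is already unset, which matches `pred 0`.
  regCode (dec r)    = seekReg r ⨾ go left ⨾ set r false ⨾ home

  walk : ℕ → ℕ
  walk n = 2 + n * 3

  -- The two single steps are those of `dec`, the longest instruction: one to step left and one to
  -- clear the track.
  regCost : ℕ → ℕ
  regCost N = walk N + (1 + (1 + walk N))

  module _ (x : List Bool) (ρ : ℕ → Bool) where

    𝓑 : Model W (CellAct W (3 + R))
    𝓑 = cellModel x ρ

    act-run : ∀ f v i cells p {c} → cells p ≡ c →
              Run 𝓑 (act f) (mkCells v i cells p) 1 (commitC x (mkCells v i cells p) (f v (readIn x i) c (ρ p)))
    act-run f v i cells p refl = act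

    peek-run : ∀ f v b i cells p {c} → cells p ≡ c →
               Run 𝓑 (peek f) (mkCells (v , b) i cells p) 1 (mkCells (v , f c) i (upd cells p c) p)
    peek-run f v b i cells p e = act-run _ (v , b) i cells p e

    module _ (rs : Vec ℕ R) (u w : ℕ → Bool) where

      Holds : (ℕ → Vec Bool (3 + R)) → Set
      Holds cells = ∀ q → cells q ≡ encode rs u w q

      holds-upd : ∀ {cells} p → Holds cells → Holds (upd cells p (cells p))
      holds-upd {cells} p h q = trans (upd-id cells p q) (h q)

      holds-enc : ∀ {cells} p → Holds cells → Holds (upd cells p (encode rs u w p))
      holds-enc {cells} p h q = subst (λ c → upd cells p c q ≡ encode rs u w q) (h p) (holds-upd p h q)

      seekLoop : ∀ r v i k p {cells} → k + p ≡ lookup rs r → Holds cells →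
        Σ Bool λ b → Σ (ℕ → Vec Bool (3 + R)) λ cells′ → Holds cells′ ×
          Run 𝓑 (while proj₂ (go right ⨾ peek (isSet r))) (mkCells (v , (p <ᵇ lookup rs r)) i cells p) (1 + k * 3)
                (mkCells (v , b) i cells′ (lookup rs r))
      seekLoop r v i zero    p refl h = _ , _ , h , while-false (<ᵇ-irrefl p)
      seekLoop r v i (suc k) p {cells} e h
        with seekLoop r v i k (suc p) (trans (+-suc k p) e) (holds-enc (suc p) (holds-upd p h))
      ... | b , cells′ , h′ , run = b , cells′ , h′ ,
        while-true (<ᵇ-true (≤-trans (s≤s (m≤n+m p k)) (≤-reflexive e)))
          (seq act (peek-run (isSet r) v _ i (upd cells p (cells p)) (suc p) (holds-upd p h (suc p))))
          (subst (λ z → Run 𝓑 _ (mkCells (v , z) i _ (suc p)) _ _) (sym (lookup-map r (suc p <ᵇ_) rs)) run)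

      seekReg-run : ∀ r v b i {cells} → Holds cells →
        Σ Bool λ b′ → Σ (ℕ → Vec Bool (3 + R)) λ cells′ → Holds cells′ ×
          Run 𝓑 (seekReg r) (mkCells (v , b) i cells 0) (walk (lookup rs r)) (mkCells (v , b′) i cells′ (lookup rs r))
      seekReg-run r v b i {cells} h with seekLoop r v i (lookup rs r) 0 (+-identityʳ _) (holds-enc 0 h)
      ... | b′ , cells′ , h′ , run = b′ , cells′ , h′ ,
        seq (peek-run (isSet r) v b i cells 0 (h 0))
            (subst (λ z → Run 𝓑 _ (mkCells (v , z) i _ 0) (1 + lookup rs r * 3) (mkCells (v , b′) i cells′ (lookup rs r))) (sym (lookup-map r (0 <ᵇ_) rs)) run)

      homeLoop : ∀ v i p {cells} → Holds cells →
        Σ Bool λ b → Σ (ℕ → Vec Bool (3 + R)) λ cells′ → Holds cells′ ×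
          Run 𝓑 (while proj₂ (go left ⨾ peek notOrigin)) (mkCells (v , not (p <ᵇ 1)) i cells p) (1 + p * 3)
                (mkCells (v , b) i cells′ 0)
      homeLoop v i zero    h = _ , _ , h , while-false refl
      homeLoop v i (suc p) {cells} h with homeLoop v i p (holds-enc p (holds-upd (suc p) h))
      ... | b , cells′ , h′ , run = b , cells′ , h′ ,
        while-true refl (seq act (peek-run notOrigin v _ i (upd cells (suc p) (cells (suc p))) p (holds-upd (suc p) h p))) run

      home-run : ∀ v b i p {cells} → Holds cells →
        Σ Bool λ b′ → Σ (ℕ → Vec Bool (3 + R)) λ cells′ → Holds cells′ ×
          Run 𝓑 home (mkCells (v , b) i cells p) (walk p) (mkCells (v , b′) i cells′ 0)
      home-run v b i p {cells} h with homeLoop v i p (holds-enc p h)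
      ... | b′ , cells′ , h′ , run = b′ , cells′ , h′ , seq (peek-run notOrigin v b i cells p (h p)) run

    record Stores (b : ℕ) (σ : CellTape W (3 + R)) (s : RegState V R) : Set where
      constructor stores
      field
        mem≡   : proj₁ (CellTape.mem σ) ≡ RegState.mem s
        inp≡   : CellTape.inp σ ≡ RegState.inp s
        pos≡   : CellTape.pos σ ≡ 0
        cells≡ : Holds (RegState.regs s) (RegState.arr₁ s) (RegState.arr₂ s) (CellTape.cells σ)
        regs≤  : ∀ r → lookup (RegState.regs s) r ≤ b

    walk-mono : ∀ {m n} → m ≤ n → walk m ≤ walk n
    walk-mono l = s≤s (s≤s (*-monoˡ-≤ 3 l))

    regSim : ∀ N a {b σ s} → b < N → Stores b σ s →
             Σ (CellTape W (3 + R)) λ σ′ → Run 𝓑 (regCode a) σ (regCost N) σ′ × Stores (suc b) σ′ (regApp x ρ a s)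
    regSim N (ctl f) {b} {mkCells (v , fl) i cells _} {mkRegs _ _ rs u w} lt (stores refl refl refl h reg≤) =
      _ , slack (s≤s z≤n) (act-run _ _ _ _ 0 (h 0))
        , stores refl refl refl (holds-enc rs u w 0 h) λ r → ≤-trans (reg≤ r) (n≤1+n b)
    regSim N (look a f) {b} {mkCells (v , fl) i cells _} {mkRegs _ _ rs u w} lt (stores refl refl refl h reg≤)
      with seekReg-run rs u w a v fl i h
    ... | fl₁ , cells₁ , h₁ , run₁ = _ , slack bound (seq run₁ (seq (act-run _ _ _ _ p (h₁ p)) (proj₂ (proj₂ (proj₂ back)))))
                                   , stores refl refl refl (proj₁ (proj₂ (proj₂ back))) λ r → ≤-trans (reg≤ r) (n≤1+n b)
      where
      p = lookup rs a
      res = f v (readIn x i) (ρ p) (u p) (w p) (map (p <ᵇ_) rs)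
      u′ = upd u p (proj₁ (proj₂ res))
      w′ = upd w p (proj₁ (proj₂ (proj₂ res)))
      c′ : Vec Bool (3 + R)
      c′ = (p <ᵇ 1) ∷ proj₁ (proj₂ res) ∷ proj₁ (proj₂ (proj₂ res)) ∷ map (p <ᵇ_) rs
      h₂ : Holds rs u′ w′ (upd cells₁ p c′)
      h₂ q with q ≟ p
      ... | yes refl = trans (upd-same cells₁ q c′)
                         (cong₂ (λ y z → (q <ᵇ 1) ∷ y ∷ z ∷ map (q <ᵇ_) rs) (sym (upd-same u q _)) (sym (upd-same w q _)))
      ... | no q≢p   = trans (upd-other cells₁ p c′ q≢p) (trans (h₁ q)
                         (cong₂ (λ y z → (q <ᵇ 1) ∷ y ∷ z ∷ map (q <ᵇ_) rs) (sym (upd-other u p _ q≢p)) (sym (upd-other w p _ q≢p))))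
      back = home-run rs u′ w′ (proj₁ res) fl₁ (move (proj₂ (proj₂ (proj₂ res))) (suc (length x)) i) p h₂
      p≤ : p ≤ N
      p≤ = ≤-trans (reg≤ a) (<⇒≤ lt)
      bound : walk p + (1 + walk p) ≤ regCost N
      bound = +-mono-≤ (walk-mono (p≤)) (s≤s (≤-trans (walk-mono (p≤)) (n≤1+n _)))
    regSim N (inc r) {b} {mkCells (v , fl) i cells _} {mkRegs _ _ rs u w} lt (stores refl refl refl h reg≤)
      with seekReg-run rs u w r v fl i h
    ... | fl₁ , cells₁ , h₁ , run₁ = _ , slack bound (seq run₁ (seq (act-run _ _ _ _ n (h₁ n)) (proj₂ (proj₂ (proj₂ back)))))
                                   , stores refl refl refl (proj₁ (proj₂ (proj₂ back)))
                                       (updateAt-bound rs r suc (n≤1+n b) s≤s reg≤)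
      where
      n = lookup rs r
      c′ : Vec Bool (3 + R)
      c′ = (n <ᵇ 1) ∷ u n ∷ w n ∷ map (n <ᵇ_) rs [ r ]≔ true
      h₂ : Holds (updateAt rs r suc) u w (upd cells₁ n c′)
      h₂ q with q ≟ n
      ... | yes refl = trans (upd-same cells₁ q c′) (cong (λ z → (q <ᵇ 1) ∷ u q ∷ w q ∷ z)
                         (map-updateAt-set rs r suc q (<ᵇ-true (n<1+n q))))
      ... | no q≢n   = trans (upd-other cells₁ n c′ q≢n) (trans (h₁ q) (cong (λ z → (q <ᵇ 1) ∷ u q ∷ w q ∷ z)
                         (sym (map-updateAt-same rs r suc q (<ᵇ-sucʳ q n q≢n)))))
      back = home-run (updateAt rs r suc) u w v fl₁ i n h₂
      n≤ : n ≤ N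
      n≤ = ≤-trans (reg≤ r) (<⇒≤ lt)
      bound : walk n + (1 + walk n) ≤ regCost N
      bound = +-mono-≤ (walk-mono n≤) (s≤s (≤-trans (walk-mono n≤) (n≤1+n _)))
    regSim N (dec r) {b} {mkCells (v , fl) i cells _} {mkRegs _ _ rs u w} lt (stores refl refl refl h reg≤)
      with seekReg-run rs u w r v fl i h
    ... | fl₁ , cells₁ , h₁ , run₁ = _ , slack bound (seq run₁ (seq act (seq (act-run _ _ _ _ p (h₂ p)) (proj₂ (proj₂ (proj₂ back))))))
                                   , stores refl refl refl (proj₁ (proj₂ (proj₂ back)))
                                       (updateAt-bound rs r pred (n≤1+n b) (λ {a} l → ≤-trans (pred[n]≤n {a}) (≤-trans l (n≤1+n b))) reg≤)
      where
      n = lookup rs r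
      p = n ∸ 1
      cells₂ = upd cells₁ n (cells₁ n)
      h₂ = holds-upd rs u w n h₁
      p≡ : ∀ m → m ∸ 1 ≡ pred m
      p≡ zero    = refl
      p≡ (suc m) = refl
      c′ : Vec Bool (3 + R)
      c′ = (p <ᵇ 1) ∷ u p ∷ w p ∷ map (p <ᵇ_) rs [ r ]≔ false
      h₃ : Holds (updateAt rs r pred) u w (upd cells₂ p c′)
      h₃ q with q ≟ p
      ... | yes refl = trans (upd-same cells₂ q c′) (cong (λ z → (q <ᵇ 1) ∷ u q ∷ w q ∷ z)
                         (map-updateAt-set rs r pred q (trans (cong (q <ᵇ_) (sym (p≡ n))) (<ᵇ-irrefl q))))
      ... | no q≢p   = trans (upd-other cells₂ p c′ q≢p) (trans (h₂ q) (cong (λ z → (q <ᵇ 1) ∷ u q ∷ w q ∷ z)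
                         (sym (map-updateAt-same rs r pred q (<ᵇ-pred q n (λ e → q≢p (trans e (sym (p≡ n)))))))))
      back = home-run (updateAt rs r pred) u w v fl₁ i p h₃
      n≤ : n ≤ N
      n≤ = ≤-trans (reg≤ r) (<⇒≤ lt)
      bound : walk n + (1 + (1 + walk p)) ≤ regCost N
      bound = +-mono-≤ (walk-mono n≤) (s≤s (s≤s (walk-mono (≤-trans (m∸n≤m n 1) n≤))))

    regRefines : ∀ N → Refines 𝓑 (regModel x ρ) N (regCost N)
    regRefines N = record
      { h = proj₁ ; code = regCode ; R = Stores
      ; val≡ = Stores.mem≡
      ; mono = λ { l (stores e₁ e₂ e₃ e₄ e₅) → stores e₁ e₂ e₃ e₄ (λ r → ≤-trans (e₅ r) l) }
      ; sim = regSim N }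

-- Polynomially bounded functions

infixl 6 _+ᵖ_
infixl 7 _*ᵖ_
infixl 8 _^ᵖ_

-- The base `2 + n` is at least two for every `n`, so constants and sums are absorbed by a larger
-- exponent and no leading coefficient is needed.
Poly : (ℕ → ℕ) → Set
Poly f = Σ ℕ λ e → ∀ n → f n ≤ (2 + n) ^ e

n≤2^n : ∀ n → n ≤ 2 ^ n
n≤2^n zero    = z≤n
n≤2^n (suc n) = ≤-trans (+-mono-≤ (m^n>0 2 n) (n≤2^n n)) (≤-reflexive (cong (2 ^ n +_) (sym (+-identityʳ (2 ^ n)))))

constᵖ : ∀ c → Poly (λ _ → c)
constᵖ c = c , λ n → ≤-trans (n≤2^n c) (^-monoˡ-≤ c (m≤m+n 2 n))

idᵖ : Poly (λ n → n)
idᵖ = 1 , λ n → ≤-trans (m≤n+m n 2) (≤-reflexive (sym (*-identityʳ (2 + n))))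

_+ᵖ_ : ∀ {f g} → Poly f → Poly g → Poly (λ n → f n + g n)
(a , p) +ᵖ (b , q) = 1 + (a + b) , λ n → ≤-trans
  (+-mono-≤ (≤-trans (p n) (^-monoʳ-≤ (2 + n) (m≤m+n a b))) (≤-trans (q n) (^-monoʳ-≤ (2 + n) (m≤n+m b a))))
  (≤-trans (≤-reflexive (cong ((2 + n) ^ (a + b) +_) (sym (+-identityʳ _)))) (*-monoˡ-≤ ((2 + n) ^ (a + b)) (m≤m+n 2 n)))

_*ᵖ_ : ∀ {f g} → Poly f → Poly g → Poly (λ n → f n * g n)
(a , p) *ᵖ (b , q) = a + b , λ n → ≤-trans (*-mono-≤ (p n) (q n)) (≤-reflexive (sym (^-distribˡ-+-* (2 + n) a b)))

_^ᵖ_ : ∀ {f} → Poly f → ∀ e → Poly (λ n → f n ^ e)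
p ^ᵖ zero  = constᵖ 1
p ^ᵖ suc e = p *ᵖ (p ^ᵖ e)

≤ᵖ : ∀ {f g} → (∀ n → f n ≤ g n) → Poly g → Poly f
≤ᵖ h (a , p) = a , λ n → ≤-trans (h n) (p n)

polyTimeᵖ : ∀ K → Poly (polyTime K)
polyTimeᵖ K = idᵖ ^ᵖ K +ᵖ constᵖ K

-- The exponent serves two ranges. For `n ≤ 1` the power `n ^ K` does not grow and the summand `K`
-- must exceed `3 ^ e`; from `n = 2` on, `2 + n ≤ n ^ 2` makes `n ^ (2 * e)` sufficient.
poly⇒polyTime : ∀ {f} → Poly f → Σ ℕ λ K → ∀ n → f n ≤ polyTime K n
poly⇒polyTime (e , p) = 3 ^ e + 2 * e , λ n → ≤-trans (p n) (bound n)
  where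
  K = 3 ^ e + 2 * e
  bound : ∀ n → (2 + n) ^ e ≤ polyTime K n
  bound zero = ≤-trans (^-monoˡ-≤ e (n≤1+n 2)) (≤-trans (m≤m+n (3 ^ e) (2 * e)) (m≤n+m K (0 ^ K)))
  bound (suc zero) = ≤-trans (m≤m+n (3 ^ e) (2 * e)) (m≤n+m K (1 ^ K))
  bound n@(suc (suc m)) = begin
    (2 + n) ^ e     ≤⟨ ^-monoˡ-≤ e (square m) ⟩
    (n ^ 2) ^ e     ≡⟨ ^-*-assoc n 2 e ⟩
    n ^ (2 * e)     ≤⟨ ^-monoʳ-≤ n (m≤n+m (2 * e) (3 ^ e)) ⟩
    n ^ K           ≤⟨ m≤m+n (n ^ K) K ⟩
    polyTime K n    ∎
    where
    open ≤-Reasoning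
    square : ∀ m → 4 + m ≤ (2 + m) ^ 2
    square m = ≤-trans (m≤m+n (4 + m) (3 * m + m * m)) (≤-reflexive (lin m))
      where
      lin : ∀ m → 4 + m + (3 * m + m * m) ≡ (2 + m) * ((2 + m) * 1)
      lin = solve-∀

-- The logarithm recurses along an accessibility proof, so its unfolding holds only up to
-- irrelevance of that proof.
⌈log₂⌉-half : ∀ m → ⌈log₂ 2 + m ⌉ ≡ suc ⌈log₂ suc ⌈ m /2⌉ ⌉
⌈log₂⌉-half m = cong suc (⌈log2⌉-acc-irrelevant (suc ⌈ m /2⌉))

-- With `j = 2 + m` the bound is twice `j - 1`. This sharp form survives halving, because the
-- ceiling of `j / 2` minus one is the floor of `(j - 1) / 2`, so rounding up loses nothing.
2^⌈log₂⌉ : ∀ m → Acc _<_ m → 2 ^ ⌈log₂ 2 + m ⌉ ≤ 2 * suc m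
2^⌈log₂⌉ zero    _        = ≤-refl
2^⌈log₂⌉ (suc m) (acc rs) = begin
  2 ^ ⌈log₂ 3 + m ⌉                 ≡⟨ cong (2 ^_) (⌈log₂⌉-half (suc m)) ⟩
  2 * 2 ^ ⌈log₂ 2 + ⌊ m /2⌋ ⌉       ≤⟨ *-monoʳ-≤ 2 (2^⌈log₂⌉ ⌊ m /2⌋ (rs (s≤s (⌊n/2⌋≤n m)))) ⟩
  2 * (2 * suc ⌊ m /2⌋)             ≤⟨ *-monoʳ-≤ 2 (double m) ⟩
  2 * suc (suc m)                   ∎
  where
  open ≤-Reasoning
  double : ∀ m → 2 * suc ⌊ m /2⌋ ≤ suc (suc m)
  double m = ≤-trans (≤-reflexive (cong (suc ⌊ m /2⌋ +_) (+-identityʳ _)))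
    (≤-trans (≤-reflexive (cong suc (+-suc ⌊ m /2⌋ ⌊ m /2⌋)))
      (s≤s (s≤s (≤-trans (+-monoʳ-≤ ⌊ m /2⌋ (⌊n/2⌋≤⌈n/2⌉ m)) (≤-reflexive (⌊n/2⌋+⌈n/2⌉≡n m))))))

2^log₂ᵖ : Poly (λ n → 2 ^ ⌈log₂ n ⌉)
2^log₂ᵖ = ≤ᵖ bound (constᵖ 2 *ᵖ idᵖ +ᵖ constᵖ 1)
  where
  bound : ∀ n → 2 ^ ⌈log₂ n ⌉ ≤ 2 * n + 1
  bound zero          = ≤-refl
  bound (suc zero)    = s≤s z≤n
  bound (suc (suc m)) = ≤-trans (2^⌈log₂⌉ m (<-wellFounded m)) (≤-trans (*-monoʳ-≤ 2 (n≤1+n (suc m))) (m≤m+n _ 1))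

2^workSpaceᵖ : ∀ k → Poly (λ n → 2 ^ workSpace k n)
2^workSpaceᵖ k = ≤ᵖ (λ n → ≤-reflexive (trans (cong (2 ^_) (*-comm k ⌈log₂ n ⌉)) (sym (^-*-assoc 2 ⌈log₂ n ⌉ k)))) (2^log₂ᵖ ^ᵖ k)

workSpaceᵖ : ∀ k → Poly (workSpace k)
workSpaceᵖ k = ≤ᵖ (λ n → n≤2^n (workSpace k n)) (2^workSpaceᵖ k)

catSpaceᵖ : ∀ k → Poly (catSpace k)
catSpaceᵖ k = idᵖ ^ᵖ k

-- Register programs for the deadline and the tape lengths

is-just-readIn : ∀ x p → is-just (readIn x (suc p)) ≡ (p <ᵇ length x)
is-just-readIn []      p       = refl
is-just-readIn (b ∷ x) zero    = refl
is-just-readIn (b ∷ x) (suc p) = is-just-readIn x p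

rAcc rTmp rClk rWLen rCLen rWPos rCPos : Fin 7
rAcc  = 0F
rTmp  = 1F
rClk  = 2F
rWLen = 3F
rCLen = 4F
rWPos = 5F
rCPos = 6F

Regs : Set
Regs = Vec ℕ 7

addCost : ℕ → ℕ
addCost n = 6 + n * 5

mulCost : ℕ → ℕ → ℕ
mulCost n a = (2 + a * (3 + addCost n)) + (2 + a * n * 4)

powCost : ℕ → ℕ → ℕ
powCost n zero    = 1
powCost n (suc e) = powCost n e + mulCost n (n ^ e)

logIter : ℕ → ℕ → ℕ
logIter k N = 7 + k + N * 11

logCost : ℕ → ℕ → ℕ
logCost n k = addCost n + (1 + (1 + (1 + n * logIter k n)))

setupCost : ℕ → ℕ → ℕ → ℕ
setupCost n k K =
  powCost n K + ((2 + n ^ K * 4) + (suc K + (powCost n k + ((2 + n ^ k * 4) + logCost n k))))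

module Setup {Q : ℕ} where

  -- The components are the state of the simulated machine, the result of the last test, the work
  -- bit in transit, and the pending moves of the work head and the catalytic head.
  V : Set
  V = Fin Q × Bool × Bool × Move × Move

  RProg : Set
  RProg = Prog V (RegAct V 7)

  flag : V → Bool
  flag (_ , b , _) = b

  setFlag : Bool → V → V
  setFlag b (q , _ , a , ms) = q , b , a , ms

  nop : RProg
  nop = act (ctl λ v i bs → v , stay)

  tst : Fin 7 → RProg
  tst r = act (ctl λ v i bs → setFlag (lookup bs r) v , stay)

  stepIn : Move → RProg
  stepIn d = act (ctl λ v i bs → v , d)

  scanIn : Move → RProg
  scanIn d = act (ctl λ v i bs → setFlag (is-just i) v , d)

  loop : Fin 7 → RProg → RProg
  loop r P = tst r ⨾ while flag (act (dec r) ⨾ P ⨾ tst r)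

  transfer : Fin 7 → Fin 7 → RProg
  transfer r r′ = loop r (act (inc r′))

  incs : ℕ → Fin 7 → RProg
  incs zero    r = nop
  incs (suc m) r = act (inc r) ⨾ incs m r

  -- The input length is found by walking over the input and back. `scanIn` tests the symbol that
  -- the head leaves: at the right end marker the head is held in cell `n + 1`, so one left step
  -- precedes the way back, and at the left end marker it is held in cell `0`.
  addN : RProg
  addN = stepIn right ⨾ scanIn right ⨾ while flag (act (inc rTmp) ⨾ scanIn right) ⨾
         stepIn left ⨾ scanIn left ⨾ while flag (scanIn left)

  mulN : RProg
  mulN = loop rAcc addN ⨾ transfer rTmp rAcc

  powN : ℕ → RProg
  powN zero    = act (inc rAcc)
  powN (suc e) = powN e ⨾ mulN

  halveLoop : RProg
  halveLoop = while flag (act (dec rTmp) ⨾ tst rTmp ⨾ ite flag (act (dec rTmp) ⨾ act (inc rAcc)) nop ⨾ tst rTmp)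

  halve : RProg
  halve = tst rTmp ⨾ halveLoop ⨾ transfer rAcc rTmp

  logLoop : ℕ → RProg
  logLoop k = while flag (halve ⨾ incs k rWLen ⨾ tst rTmp)

  -- Halving `n - 1` with rounding down reaches zero after exactly `⌈log₂ n⌉` rounds; adding `k` in
  -- each round replaces a multiplication. Since `dec` leaves zero unchanged, `n = 0` is treated
  -- like `n = 1`, and both logarithms are zero.
  logN : ℕ → RProg
  logN k = addN ⨾ act (dec rTmp) ⨾ tst rTmp ⨾ logLoop k

  setup : ℕ → ℕ → RProg
  setup k K = powN K ⨾ transfer rAcc rClk ⨾ incs K rClk ⨾ powN k ⨾ transfer rAcc rCLen ⨾ logN k

  module _ (x : List Bool) (ρ : ℕ → Bool) (v : V) (u w : ℕ → Bool) where

    n : ℕ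
    n = length x

    𝓡 : Model V (RegAct V 7)
    𝓡 = regModel x ρ

    at : ℕ → Bool → Regs → RegState V 7
    at i b rs = mkRegs (setFlag b v) i rs u w

    infix 3 _⊢_,_⇒[_]_,_
    _⊢_,_⇒[_]_,_ : RProg → Bool → Regs → ℕ → Bool → Regs → Set
    P ⊢ b , rs ⇒[ m ] b′ , rs′ = Run 𝓡 P (at 0 b rs) m (at 0 b′ rs′)

    tst-run : ∀ r {b rs c} → (0 <ᵇ lookup rs r) ≡ c → tst r ⊢ b , rs ⇒[ 1 ] c , rs
    tst-run r {b} {rs} refl =
      subst (λ z → tst r ⊢ b , rs ⇒[ 1 ] z , rs) (lookup-map r (0 <ᵇ_) rs) act

    -- The family `g` describes the registers by the loop counter and one accumulated value, to
    -- which every round adds `c`. Multiplication and the transfer between registers are instances.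
    loop-run : ∀ r P c m (g : ℕ → ℕ → Regs) →
      (∀ j y → lookup (g j y) r ≡ j) →
      (∀ j y b → Σ Bool λ b′ → P ⊢ b , updateAt (g (suc j) y) r pred ⇒[ m ] b′ , g j (c + y)) →
      ∀ j y {b} → loop r P ⊢ b , g j y ⇒[ 2 + j * (3 + m) ] false , g 0 (j * c + y)
    loop-run r P c m g cnt body j₀ y₀ =
      seq (tst-run r (cong (0 <ᵇ_) (cnt j₀ y₀))) (go j₀ y₀)
      where
      go : ∀ j y → while flag (act (dec r) ⨾ P ⨾ tst r) ⊢ (0 <ᵇ j) , g j y ⇒[ 1 + j * (3 + m) ] false , g 0 (j * c + y)
      go zero    y = while-false refl
      go (suc j) y with body j y true
      ... | b′ , run = slack (≤-reflexive (cost m (j * (3 + m))))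
        (while-true refl (seq act (seq run (tst-run r (cong (0 <ᵇ_) (cnt j (c + y))))))
          (subst (λ z → while flag (act (dec r) ⨾ P ⨾ tst r) ⊢ (0 <ᵇ j) , g j (c + y) ⇒[ 1 + j * (3 + m) ] false , g 0 z)
                 (sum≡ j c y) (go j (c + y))))
        where
        cost : ∀ m q → suc (1 + (m + 1) + (1 + q)) ≡ 1 + (3 + m + q)
        cost = solve-∀
        sum≡ : ∀ j c y → j * c + (c + y) ≡ c + j * c + y
        sum≡ = solve-∀

    transfer-run : ∀ r r′ (g : ℕ → ℕ → Regs) →
      (∀ j y → lookup (g j y) r ≡ j) →
      (∀ j y → updateAt (updateAt (g (suc j) y) r pred) r′ suc ≡ g j (suc y)) →
      ∀ j y {b} → transfer r r′ ⊢ b , g j y ⇒[ 2 + j * 4 ] false , g 0 (j + y)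
    transfer-run r r′ g cnt body j y {b} =
      subst (λ z → transfer r r′ ⊢ b , g j y ⇒[ 2 + j * 4 ] false , g 0 (z + y)) (*-identityʳ j)
        (loop-run r (act (inc r′)) 1 1 g cnt
          (λ j y b → b , subst (λ z → act (inc r′) ⊢ b , updateAt (g (suc j) y) r pred ⇒[ 1 ] b , z) (body j y) act) j y)

    incs-run : ∀ m r (g : ℕ → Regs) → (∀ y → updateAt (g y) r suc ≡ g (suc y)) →
      ∀ y {b} → incs m r ⊢ b , g y ⇒[ suc m ] b , g (m + y)
    incs-run zero    r g body y = act
    incs-run (suc m) r g body y {b} =
      seq (subst (λ z → act (inc r) ⊢ b , g y ⇒[ 1 ] b , z) (body y) act)
          (subst (λ z → incs m r ⊢ b , g (suc y) ⇒[ suc m ] b , g z) (+-suc m y) (incs-run m r g body (suc y)))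

    module _ (rest : Vec ℕ 5) where

      private
        g : ℕ → ℕ → Regs
        g a t = a ∷ t ∷ rest

        clamp : ∀ {p} → p ≤ n → move right (suc n) p ≡ suc p
        clamp {p} l = cong (λ z → if z then suc p else p) (<ᵇ-true (s≤s l))

      -- The invariant is taken just after a scan: the flag reports cell `suc p`, the head has
      -- already moved past it, and `j` input cells from that one on are still uncounted.
      scan-up : ∀ a j p y → j + p ≡ n →
        Run 𝓡 (while flag (act (inc rTmp) ⨾ scanIn right))
          (at (move right (suc n) (suc p)) (is-just (readIn x (suc p))) (g a y)) (1 + j * 3)
          (at (suc n) false (g a (j + y)))
      scan-up a zero p y refl rewrite is-just-readIn x p | <ᵇ-irrefl p = while-false refl
      scan-up a (suc j) p y e =
        subst₂ (λ i b → Run 𝓡 _ (at i b (g a y)) (4 + j * 3) (at (suc n) false (g a (suc j + y))))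
          (sym (clamp p<n)) (sym (trans (is-just-readIn x p) (<ᵇ-true p<n)))
          (while-true refl (seq act act)
            (subst (λ z → Run 𝓡 (while flag (act (inc rTmp) ⨾ scanIn right))
                     (at (move right (suc n) (suc (suc p))) (is-just (readIn x (suc (suc p)))) (g a (suc y)))
                     (1 + j * 3) (at (suc n) false (g a z))) (+-suc j y)
              (scan-up a j (suc p) (suc y) (trans (+-suc j p) e))))
        where
        p<n : suc p ≤ n
        p<n = ≤-trans (s≤s (m≤n+m p j)) (≤-reflexive e)

      scan-down : ∀ rs p → p ≤ n →
        Run 𝓡 (while flag (scanIn left)) (at (p ∸ 1) (is-just (readIn x p)) rs) (1 + p * 2) (at 0 false rs)
      scan-down rs zero    l = while-false refl
      scan-down rs (suc p) l =
        subst (λ b → Run 𝓡 _ (at p b rs) (3 + p * 2) (at 0 false rs))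
          (sym (trans (is-just-readIn x p) (<ᵇ-true l)))
          (while-true refl act (scan-down rs p (<⇒≤ l)))

      addN-run : ∀ a y {b} → addN ⊢ b , g a y ⇒[ addCost n ] false , g a (n + y)
      addN-run a y {b} = slack (≤-reflexive (cost n))
        (seq (subst (λ i → Run 𝓡 (stepIn right) (at 0 b (g a y)) 1 (at i b (g a y))) (clamp z≤n) act)
          (seq act (seq (scan-up a n 0 y (+-identityʳ n))
            (seq act (seq act (scan-down (g a (n + y)) n ≤-refl))))))
        where
        cost : ∀ n → 1 + (1 + (1 + n * 3 + (1 + (1 + (1 + n * 2))))) ≡ 6 + n * 5
        cost = solve-∀

      mulN-run : ∀ a {b} → mulN ⊢ b , g a 0 ⇒[ mulCost n a ] false , g (n * a) 0
      mulN-run a {b} = subst (λ z → mulN ⊢ b , g a 0 ⇒[ mulCost n a ] false , g z 0)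
        (trans (+-identityʳ (a * n)) (*-comm a n))
        (seq (subst (λ z → loop rAcc addN ⊢ b , g a 0 ⇒[ 2 + a * (3 + addCost n) ] false , g 0 z) (+-identityʳ (a * n))
               (loop-run rAcc addN n (addCost n) g (λ _ _ → refl) (λ j y b → false , addN-run j y) a 0))
             (transfer-run rTmp rAcc (λ j y → g y j) (λ _ _ → refl) (λ _ _ → refl) (a * n) 0))

      powN-run : ∀ e {b} → Σ Bool λ b′ → powN e ⊢ b , g 0 0 ⇒[ powCost n e ] b′ , g (n ^ e) 0
      powN-run zero    {b} = b , act
      powN-run (suc e) with powN-run e
      ... | _ , run = false , seq run (mulN-run (n ^ e))

      halveLoop-run : ∀ m y → halveLoop ⊢ (0 <ᵇ m) , g y m ⇒[ 1 + m * 7 ] false , g (⌊ m /2⌋ + y) 0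
      halveLoop-run zero          y = while-false refl
      halveLoop-run (suc zero)    y =
        slack (n≤1+n 7) (while-true refl (seq act (seq act (seq (ite-false refl act) act))) (while-false refl))
      halveLoop-run (suc (suc m)) y =
        slack (m≤n+m (8 + m * 7) 7)
          (while-true refl (seq act (seq act (seq (ite-true refl (seq act act)) act)))
            (subst (λ z → halveLoop ⊢ (0 <ᵇ m) , g (suc y) m ⇒[ 1 + m * 7 ] false , g z 0) (+-suc ⌊ m /2⌋ y)
              (halveLoop-run m (suc y))))

      halve-run : ∀ m {b} → halve ⊢ b , g 0 m ⇒[ 4 + m * 11 ] false , g 0 ⌊ m /2⌋
      halve-run m {b} = slack bound
        (seq act (seq (halveLoop-run m 0)
          (subst (λ z → transfer rAcc rTmp ⊢ false , g z 0 ⇒[ 2 + ⌊ m /2⌋ * 4 ] false , g 0 ⌊ m /2⌋) (sym (+-identityʳ _))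
            (subst (λ z → transfer rAcc rTmp ⊢ false , g ⌊ m /2⌋ 0 ⇒[ 2 + ⌊ m /2⌋ * 4 ] false , g 0 z) (+-identityʳ _)
              (transfer-run rAcc rTmp g (λ _ _ → refl) (λ _ _ → refl) ⌊ m /2⌋ 0)))))
        where
        bound : 1 + ((1 + m * 7) + (2 + ⌊ m /2⌋ * 4)) ≤ 4 + m * 11
        bound = ≤-trans (+-monoʳ-≤ (2 + m * 7) (+-monoʳ-≤ 2 (*-monoˡ-≤ 4 (⌊n/2⌋≤n m)))) (≤-reflexive (lin m))
          where
          lin : ∀ m → 2 + m * 7 + (2 + m * 4) ≡ 4 + m * 11
          lin = solve-∀

    -- The cost charges one round for every unit of `m`, although there are only logarithmically
    -- many rounds; a polynomial bound is all that is wanted.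
    logLoop-run : ∀ k N c l wp cp m → Acc _<_ m → m ≤ N → ∀ y →
      logLoop k ⊢ (0 <ᵇ m) , 0 ∷ m ∷ c ∷ y ∷ l ∷ wp ∷ cp ∷ [] ⇒[ 1 + m * logIter k N ]
                  false , 0 ∷ 0 ∷ c ∷ ⌈log₂ suc m ⌉ * k + y ∷ l ∷ wp ∷ cp ∷ []
    logLoop-run k N c l wp cp zero    _        m≤N y = while-false refl
    logLoop-run k N c l wp cp (suc m) (acc rs) m≤N y = slack bound
      (while-true refl
        (seq (halve-run (c ∷ y ∷ l ∷ wp ∷ cp ∷ []) (suc m))
          (seq (incs-run k rWLen (λ y → 0 ∷ h ∷ c ∷ y ∷ l ∷ wp ∷ cp ∷ []) (λ _ → refl) y) act))
        (subst (λ z → logLoop k ⊢ (0 <ᵇ h) , 0 ∷ h ∷ c ∷ k + y ∷ l ∷ wp ∷ cp ∷ [] ⇒[ 1 + h * logIter k N ]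
                                  false , 0 ∷ 0 ∷ c ∷ z ∷ l ∷ wp ∷ cp ∷ [])
          log≡ (logLoop-run k N c l wp cp h (rs h<) (≤-trans (<⇒≤ h<) m≤N) (k + y))))
      where
      h = ⌊ suc m /2⌋
      h< : h < suc m
      h< = ⌊n/2⌋<n m
      logs : ⌈log₂ suc (suc m) ⌉ ≡ suc ⌈log₂ suc h ⌉
      logs = ⌈log₂⌉-half m
      log≡ : ⌈log₂ suc h ⌉ * k + (k + y) ≡ ⌈log₂ suc (suc m) ⌉ * k + y
      log≡ = trans (lin ⌈log₂ suc h ⌉ k y) (cong (λ z → z * k + y) (sym logs))
        where
        lin : ∀ a k y → a * k + (k + y) ≡ suc a * k + y
        lin = solve-∀
      bound : suc (((4 + suc m * 11) + (suc k + 1)) + (1 + h * logIter k N)) ≤ 1 + suc m * logIter k N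
      bound = ≤-trans
        (+-mono-≤ (s≤s (+-monoˡ-≤ (suc k + 1) (+-monoʳ-≤ 4 (*-monoˡ-≤ 11 m≤N)))) (s≤s (*-monoˡ-≤ (logIter k N) (s≤s⁻¹ h<))))
        (≤-reflexive (lin k N (m * logIter k N)))
        where
        lin : ∀ k N q → suc ((4 + N * 11) + (suc k + 1)) + (1 + q) ≡ 1 + (7 + k + N * 11 + q)
        lin = solve-∀

    logN-run : ∀ k c l wp cp {b} →
      logN k ⊢ b , 0 ∷ 0 ∷ c ∷ 0 ∷ l ∷ wp ∷ cp ∷ [] ⇒[ logCost n k ]
               false , 0 ∷ 0 ∷ c ∷ k * ⌈log₂ n ⌉ ∷ l ∷ wp ∷ cp ∷ []
    logN-run k c l wp cp {b} =
      seq (subst (λ z → addN ⊢ b , 0 ∷ 0 ∷ rest ⇒[ 6 + n * 5 ] false , 0 ∷ z ∷ rest) (+-identityʳ n) (addN-run rest 0 0))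
        (seq act (seq act
          (slack (s≤s (*-monoˡ-≤ (logIter k n) (pred[n]≤n {n})))
            (subst (λ z → logLoop k ⊢ (0 <ᵇ pred n) , 0 ∷ pred n ∷ rest ⇒[ 1 + pred n * logIter k n ]
                                       false , 0 ∷ 0 ∷ c ∷ z ∷ l ∷ wp ∷ cp ∷ [])
              (trans (+-identityʳ _) (trans (*-comm _ k) (cong (k *_) (log≡ n))))
              (logLoop-run k n c l wp cp (pred n) (<-wellFounded _) (pred[n]≤n {n}) 0)))))
      where
      rest : Vec ℕ 5
      rest = c ∷ 0 ∷ l ∷ wp ∷ cp ∷ []
      log≡ : ∀ n → ⌈log₂ suc (pred n) ⌉ ≡ ⌈log₂ n ⌉
      log≡ zero    = refl
      log≡ (suc n) = refl

    setup-run : ∀ k K {b} →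
      setup k K ⊢ b , 0 ∷ 0 ∷ 0 ∷ 0 ∷ 0 ∷ 0 ∷ 0 ∷ [] ⇒[ setupCost n k K ]
                  false , 0 ∷ 0 ∷ polyTime K n ∷ workSpace k n ∷ catSpace k n ∷ 0 ∷ 0 ∷ []
    setup-run k K {b} =
      subst₂ (λ y z → setup k K ⊢ b , 0 ∷ 0 ∷ 0 ∷ 0 ∷ 0 ∷ 0 ∷ 0 ∷ [] ⇒[ setupCost n k K ]
                                   false , 0 ∷ 0 ∷ y ∷ workSpace k n ∷ z ∷ 0 ∷ 0 ∷ [])
        (trans (cong (K +_) (+-identityʳ (n ^ K))) (+-comm K (n ^ K))) (+-identityʳ (n ^ k))
        (seq (proj₂ (powN-run (0 ∷ 0 ∷ 0 ∷ 0 ∷ 0 ∷ []) K))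
          (seq (transfer-run rAcc rClk (λ j y → j ∷ 0 ∷ y ∷ 0 ∷ 0 ∷ 0 ∷ 0 ∷ []) (λ _ _ → refl) (λ _ _ → refl) (n ^ K) 0)
          (seq (incs-run K rClk (λ y → 0 ∷ 0 ∷ y ∷ 0 ∷ 0 ∷ 0 ∷ 0 ∷ []) (λ _ → refl) (n ^ K + 0))
          (seq (proj₂ (powN-run (K + (n ^ K + 0) ∷ 0 ∷ 0 ∷ 0 ∷ 0 ∷ []) k))
          (seq (transfer-run rAcc rCLen (λ j y → j ∷ 0 ∷ K + (n ^ K + 0) ∷ 0 ∷ y ∷ 0 ∷ 0 ∷ []) (λ _ _ → refl) (λ _ _ → refl) (n ^ k) 0)
               (logN-run k _ _ 0 0))))))

-- Simulation of the catalytic machine by a register program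

readV-writeV-any : ∀ {t} (w : Vec Bool t) i b j →
                   readV (writeV w i b) j ≡ upd (readV w) i (if i <ᵇ t then b else readV w i) j
readV-writeV-any []      i       b j with j ≡ᵇ i
... | true  = refl
... | false = refl
readV-writeV-any (c ∷ w) zero    b zero    = refl
readV-writeV-any (c ∷ w) zero    b (suc j) = refl
readV-writeV-any (c ∷ w) (suc i) b zero    = refl
readV-writeV-any (c ∷ w) (suc i) b (suc j) = readV-writeV-any w i b j

-- On a tape of length zero the head at `0` is already outside: reading gives `false` and writing is
-- lost. The unbounded arrays of the simulator have to imitate both.
readV-outside : ∀ {t} (w : Vec Bool t) i → (i <ᵇ t) ≡ false → readV w i ≡ false
readV-outside []      i       e = refl
readV-outside (c ∷ w) (suc i) e = readV-outside w i e

xor-cancelʳ : ∀ a b → (a xor b) xor b ≡ a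
xor-cancelʳ false false = refl
xor-cancelʳ false true  = refl
xor-cancelʳ true  false = refl
xor-cancelʳ true  true  = refl

move-right : ∀ s p → move right (s ∸ 1) p ≡ (if suc p <ᵇ s then suc p else p)
move-right zero    p = refl
move-right (suc s) p = refl

module CatSteps (M : CatMachine) (x : List Bool) {s c : ℕ} where
  open CatMachine M

  catNext : CatConfig s c Q → Fin Q × Bool × Bool × Move × Move × Move → CatConfig s c Q
  catNext (cfg q i w wi τ ci) (q′ , bw , bc , mi , mw , mc) =
    cfg q′ (move mi (suc (length x)) i) (writeV w wi bw) (move mw (s ∸ 1) wi) (writeV τ ci bc) (move mc (c ∸ 1) ci)

  catStep-run : ∀ {q} i w wi τ ci → halt q ≡ nothing →
    catStep M x (cfg q i w wi τ ci) ≡ catNext (cfg q i w wi τ ci) (δ q (readIn x i) (readV w wi) (readV τ ci))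
  catStep-run i w wi τ ci e rewrite e = refl

  catStep-halt : ∀ (cf : CatConfig s c Q) {b} → halt (CatConfig.state cf) ≡ just b → catStep M x cf ≡ cf
  catStep-halt (cfg q i w wi τ ci) e rewrite e = refl

simCost : ℕ → ℕ → ℕ → ℕ
simCost n k K = setupCost n k K + (1 + (1 + polyTime K n * 18))

module Simulation (M : CatMachine) where
  open CatMachine M
  open Setup {Q}

  isLeft isRight : Move → Bool
  isLeft left  = true
  isLeft stay  = false
  isLeft right = false
  isRight left  = false
  isRight stay  = false
  isRight right = true

  readWork : RProg
  readWork = act (look rWPos λ (q , b , _ , ms) i r u w bs → (q , b , u , ms) , u , w , stay)

  -- The catalytic bit is the random bit, corrected by the second array.
  transition : RProg
  transition = act (look rCPos λ (q , b , a , _) i r u w bs →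
    let (q′ , bw , bc , mi , mw , mc) = δ q i a (lookup bs rCLen ∧ (w xor r))
    in (q′ , b , bw , mw , mc) , u , (if lookup bs rCLen then bc xor r else w) , mi)

  writeWork : RProg
  writeWork = act (look rWPos λ (q , b , a , ms) i r u w bs →
    (q , b , a , ms) , (if lookup bs rWLen then a else u) , w , stay)

  inside : Fin 7 → Fin 7 → RProg
  inside r l = act (look r λ v i _ u w bs → setFlag (lookup bs l) v , u , w , stay)

  -- A right move is made first and undone if it left the tape, because `look` compares the length
  -- only with the current value of the address register.
  moveReg : (Move × Move → Move) → Fin 7 → Fin 7 → RProg
  moveReg sel r l =
    ite (λ (_ , _ , _ , ms) → isLeft (sel ms)) (act (dec r))
      (ite (λ (_ , _ , _ , ms) → isRight (sel ms)) (act (inc r) ⨾ inside r l ⨾ ite flag nop (act (dec r))) nop)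

  simStep : RProg
  simStep = readWork ⨾ transition ⨾ writeWork ⨾ moveReg proj₁ rWPos rWLen ⨾ moveReg proj₂ rCPos rCLen

  running : V → Bool
  running (q , b , _) = b ∧ is-nothing (halt q)

  simLoop : RProg
  simLoop = while running (act (dec rClk) ⨾ simStep ⨾ tst rClk)

  program : ℕ → ℕ → RProg
  program k K = setup k K ⨾ tst rClk ⨾ simLoop

  module _ (x : List Bool) (ρ : ℕ → Bool) where

    𝓜 : Model V (RegAct V 7)
    𝓜 = regModel x ρ

    moveReg-run : ∀ sel r l (g : ℕ → Regs) s →
      (∀ p → updateAt (g p) r suc ≡ g (suc p)) → (∀ p → updateAt (g p) r pred ≡ g (pred p)) →
      (∀ p → lookup (g p) r ≡ p) → (∀ p → lookup (g p) l ≡ s) →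
      ∀ q b a ms i p u w →
      Σ Bool λ b′ → Σ (ℕ → Bool) λ u′ → Σ (ℕ → Bool) λ w′ →
        (∀ j → u′ j ≡ u j) × (∀ j → w′ j ≡ w j) ×
        Run 𝓜 (moveReg sel r l) (mkRegs (q , b , a , ms) i (g p) u w) 6
              (mkRegs (q , b′ , a , ms) i (g (move (sel ms) (s ∸ 1) p)) u′ w′)
    moveReg-run sel r l g s hs hp hr hl q b a ms i p u w with sel ms in e
    ... | left  = b , u , w , (λ _ → refl) , (λ _ → refl)
                , slack (s≤s (s≤s z≤n)) (ite-true (cong isLeft e)
                    (subst (λ z → Run 𝓜 (act (dec r)) _ 1 (mkRegs (q , b , a , ms) i z u w)) (trans (hp p) (cong g (pred≡ p))) act))
      where
      pred≡ : ∀ m → pred m ≡ m ∸ 1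
      pred≡ zero    = refl
      pred≡ (suc m) = refl
    ... | stay  = b , u , w , (λ _ → refl) , (λ _ → refl)
                , slack (s≤s (s≤s (s≤s z≤n))) (ite-false (cong isLeft e) (ite-false (cong isRight e) act))
    ... | right = _ , _ , _ , upd-id u (suc p) , upd-id w (suc p) , ite-false (cong isLeft e) (ite-true (cong isRight e)
                    (seq (subst (λ z → Run 𝓜 (act (inc r)) _ 1 (mkRegs (q , b , a , ms) i z u w)) (hs p) act)
                      (seq inside-run final)))
      where
      c = suc p <ᵇ s
      u₁ = upd u (suc p) (u (suc p))
      w₁ = upd w (suc p) (w (suc p))
      inside-run : Run 𝓜 (inside r l) (mkRegs (q , b , a , ms) i (g (suc p)) u w) 1
                         (mkRegs (q , c , a , ms) i (g (suc p)) u₁ w₁)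
      inside-run = subst₂ (λ y z → Run 𝓜 (inside r l) (mkRegs (q , b , a , ms) i (g (suc p)) u w) 1
                           (mkRegs (q , z , a , ms) i (g (suc p)) (upd u y (u y)) (upd w y (w y))))
                     (hr (suc p)) (trans (lookup-map l (lookup (g (suc p)) r <ᵇ_) (g (suc p))) (cong₂ _<ᵇ_ (hr (suc p)) (hl (suc p))))
                     act
      final : Run 𝓜 (ite flag nop (act (dec r))) (mkRegs (q , c , a , ms) i (g (suc p)) u₁ w₁) 2
                    (mkRegs (q , c , a , ms) i (g (move right (s ∸ 1) p)) u₁ w₁)
      final rewrite move-right s p with c in e′
      ... | true  = ite-true refl act
      ... | false = ite-false refl (subst (λ z → Run 𝓜 (act (dec r)) _ 1 (mkRegs (q , false , a , ms) i z u₁ w₁)) (hp (suc p)) act)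

    module _ {s c : ℕ} where
      open CatSteps M x {s} {c}

      -- The equation for the catalytic tape is restricted to `p < c`: beyond that the random bits
      -- are arbitrary while the finite tape reads `false`. This is why `transition` consults the
      -- length before it uses the difference.
      record Sim (clk : ℕ) (cf : CatConfig s c Q) (σ : RegState V 7) : Set where
        constructor sim
        open CatConfig cf
        field
          state≡ : proj₁ (RegState.mem σ) ≡ state
          inp≡   : RegState.inp σ ≡ inPos
          regs≡  : RegState.regs σ ≡ 0 ∷ 0 ∷ clk ∷ s ∷ c ∷ wPos ∷ cPos ∷ []
          work≡  : ∀ p → RegState.arr₁ σ p ≡ readV work p
          cat≡   : ∀ {p} → p < c → (RegState.arr₂ σ p xor ρ p) ≡ readV cat p

      simStep-run : ∀ {clk cf σ} → Sim clk cf σ → halt (CatConfig.state cf) ≡ nothing →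
                    Σ (RegState V 7) λ σ′ → Run 𝓜 simStep σ 15 σ′ × Sim clk (catStep M x cf) σ′
      simStep-run {clk} {cfg q i wk wi τ ci} {mkRegs (_ , b , a , ms) _ _ u w} (sim refl refl refl work≡ cat≡) running
        = _ , seq act (seq act (seq act (seq run₁ run₂)))
            , subst (λ z → Sim clk z (mkRegs (q′ , b₂ , bw , mw , mc) _ _ u₅ w₅))
                (sym (trans (catStep-run i wk wi τ ci running) (cong (catNext (cfg q i wk wi τ ci)) (sym d≡))))
                (sim refl refl refl (λ p → trans (u₅≡ p) (trans (u₄≡ p) (u₃≡ p)))
                   (λ {p} l → trans (cong (_xor ρ p) (trans (w₅≡ p) (trans (w₄≡ p) (upd-id w₂ wi p)))) (w₂≡ p l)))
        where
        u₁ = upd u wi (u wi)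
        w₁ = upd w wi (w wi)
        catBit : (ci <ᵇ c) ∧ (w₁ ci xor ρ ci) ≡ readV τ ci
        catBit rewrite upd-id w wi ci with ci <ᵇ c in e
        ... | true  = cat≡ (<ᵇ⇒< ci c (subst T (sym e) tt))
        ... | false = sym (readV-outside τ ci e)
        d : Fin Q × Bool × Bool × Move × Move × Move
        d = δ q (readIn x i) (u wi) ((ci <ᵇ c) ∧ (w₁ ci xor ρ ci))
        d≡ : d ≡ δ q (readIn x i) (readV wk wi) (readV τ ci)
        d≡ = cong₂ (δ q (readIn x i)) (work≡ wi) catBit
        q′ = proj₁ d
        bw = proj₁ (proj₂ d)
        bc = proj₁ (proj₂ (proj₂ d))
        mi = proj₁ (proj₂ (proj₂ (proj₂ d)))
        mw = proj₁ (proj₂ (proj₂ (proj₂ (proj₂ d))))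
        mc = proj₂ (proj₂ (proj₂ (proj₂ (proj₂ d))))
        i′ = move mi (suc (length x)) i
        u₂ = upd u₁ ci (u₁ ci)
        w₂ = upd w₁ ci (if ci <ᵇ c then bc xor ρ ci else w₁ ci)
        u₃ = upd u₂ wi (if wi <ᵇ s then bw else u₂ wi)
        w₃ = upd w₂ wi (w₂ wi)
        u₂≡ : ∀ p → u₂ p ≡ readV wk p
        u₂≡ p = trans (upd-id u₁ ci p) (trans (upd-id u wi p) (work≡ p))
        u₃≡ : ∀ p → u₃ p ≡ readV (writeV wk wi bw) p
        u₃≡ p = trans (upd-cong u₂ (readV wk) wi (cong (if wi <ᵇ s then bw else_) (u₂≡ wi)) (u₂≡ p)) (sym (readV-writeV-any wk wi bw p))
        w₂≡ : ∀ p → p < c → (w₂ p xor ρ p) ≡ readV (writeV τ ci bc) p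
        w₂≡ p l with p ≟ ci
        ... | yes refl = begin
          w₂ p xor ρ p                                             ≡⟨ cong (_xor ρ p) (upd-same w₁ p _) ⟩
          (if p <ᵇ c then bc xor ρ p else w₁ p) xor ρ p            ≡⟨ cong (λ z → (if z then bc xor ρ p else w₁ p) xor ρ p) (<ᵇ-true l) ⟩
          (bc xor ρ p) xor ρ p                                     ≡⟨ xor-cancelʳ bc (ρ p) ⟩
          bc                                                       ≡⟨ upd-same (readV τ) p bc ⟨
          upd (readV τ) p bc p                                     ≡⟨ readV-writeV τ p bc l ⟨
          readV (writeV τ p bc) p                                  ∎
          where open ≡-Reasoning
        ... | no p≢ci  = begin
          w₂ p xor ρ p                 ≡⟨ cong (_xor ρ p) (trans (upd-other w₁ ci _ p≢ci) (upd-id w wi p)) ⟩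
          w p xor ρ p                  ≡⟨ cat≡ l ⟩
          readV τ p                    ≡⟨ upd-other (readV τ) ci bc p≢ci ⟨
          upd (readV τ) ci bc p        ≡⟨ readV-writeV τ ci bc l ⟨
          readV (writeV τ ci bc) p     ∎
          where open ≡-Reasoning
        M₁ = moveReg-run proj₁ rWPos rWLen (λ p → 0 ∷ 0 ∷ clk ∷ s ∷ c ∷ p ∷ ci ∷ []) s
               (λ _ → refl) (λ _ → refl) (λ _ → refl) (λ _ → refl) q′ b bw (mw , mc) i′ wi u₃ w₃
        b₁ = proj₁ M₁
        u₄ = proj₁ (proj₂ M₁)
        w₄ = proj₁ (proj₂ (proj₂ M₁))
        u₄≡ = proj₁ (proj₂ (proj₂ (proj₂ M₁)))
        w₄≡ = proj₁ (proj₂ (proj₂ (proj₂ (proj₂ M₁))))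
        run₁ = proj₂ (proj₂ (proj₂ (proj₂ (proj₂ M₁))))
        M₂ = moveReg-run proj₂ rCPos rCLen (λ p → 0 ∷ 0 ∷ clk ∷ s ∷ c ∷ move mw (s ∸ 1) wi ∷ p ∷ []) c
               (λ _ → refl) (λ _ → refl) (λ _ → refl) (λ _ → refl) q′ b₁ bw (mw , mc) i′ ci u₄ w₄
        b₂ = proj₁ M₂
        u₅ = proj₁ (proj₂ M₂)
        w₅ = proj₁ (proj₂ (proj₂ M₂))
        u₅≡ = proj₁ (proj₂ (proj₂ (proj₂ M₂)))
        w₅≡ = proj₁ (proj₂ (proj₂ (proj₂ (proj₂ M₂))))
        run₂ = proj₂ (proj₂ (proj₂ (proj₂ (proj₂ M₂))))

      -- A round takes 15 steps for `simStep` and one each for the clock, the test of the clock and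
      -- the loop condition. If the machine halts early, the loop stops, and the remaining `clk`
      -- steps of the catalytic machine change nothing.
      simLoop-run : ∀ clk {cf σ} → Sim clk cf σ → flag (RegState.mem σ) ≡ (0 <ᵇ clk) →
                    Σ (RegState V 7) λ σ′ → Run 𝓜 simLoop σ (1 + clk * 18) σ′ ×
                      proj₁ (RegState.mem σ′) ≡ CatConfig.state (iter clk (catStep M x) cf)
      simLoop-run zero {σ = mkRegs (q , _ , a , ms) i rs u w} σ~ refl = _ , while-false refl , Sim.state≡ σ~
      simLoop-run (suc clk) {cf} {mkRegs (q , _ , a , ms) i rs u w} σ~@(sim refl refl refl work≡ cat≡) refl
        with halt q in e
      ... | just y  = _ , slack (s≤s z≤n) (while-false (cong is-nothing e))
                        , cong CatConfig.state (sym (iter-fix (suc clk) (catStep M x) (catStep-halt cf e)))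
      ... | nothing with simStep-run {clk} {cf} {mkRegs (q , true , a , ms) i _ u w} (sim refl refl refl work≡ cat≡) e
      ... | mkRegs (q₁ , _ , a₁ , ms₁) i₁ _ u₁ w₁ , run₁ , sim refl refl refl work₁ cat₁
        with simLoop-run clk {catStep M x cf} {mkRegs (q₁ , (0 <ᵇ clk) , a₁ , ms₁) i₁ _ u₁ w₁}
               (sim refl refl refl work₁ cat₁) refl
      ... | σ₂ , run₂ , st₂ =
        σ₂ , while-true (cong is-nothing e) (seq act (seq run₁ act)) run₂
           , trans st₂ (cong CatConfig.state (iter-shift clk (catStep M x) cf))

    program-run : ∀ k K a ms (τ : Vec Bool (catSpace k (length x))) → (∀ {p} → p < catSpace k (length x) → ρ p ≡ readV τ p) →
      Σ (RegState V 7) λ σ′ →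
        Run 𝓜 (program k K)
            (mkRegs (start , false , a , ms) 0 (0 ∷ 0 ∷ 0 ∷ 0 ∷ 0 ∷ 0 ∷ 0 ∷ []) (λ _ → false) (λ _ → false))
            (simCost (length x) k K) σ′ ×
        proj₁ (RegState.mem σ′) ≡ CatConfig.state (iter (polyTime K (length x)) (catStep M x)
          (cfg start 0 (replicate (workSpace k (length x)) false) 0 τ 0))
    program-run k K a ms τ ρ≡
      with simLoop-run {workSpace k (length x)} (polyTime K (length x))
             {cfg start 0 (replicate (workSpace k (length x)) false) 0 τ 0}
             {mkRegs (start , (0 <ᵇ polyTime K (length x)) , a , ms) 0 _ (λ _ → false) (λ _ → false)}
             -- The difference array starts at `false`, so the invariant for the catalytic tape
             -- reduces to the agreement of `ρ` with `τ`.
             (sim refl refl refl (λ p → sym (readV-replicate (workSpace k (length x)) p)) ρ≡) refl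
    ... | σ′ , run , st = σ′ , seq (setup-run x ρ (start , false , a , ms) _ _ k K) (seq act run) , st

Finᶠ : ∀ n → Finite (Fin n)
Finᶠ n = n , ↔-id (Fin n)

Moveᶠ : Finite Move
Moveᶠ = 3 , mk↔ₛ′ (λ { left → 0F ; stay → 1F ; right → 2F }) (λ { 0F → left ; 1F → stay ; 2F → right })
                  (λ { 0F → refl ; 1F → refl ; 2F → refl }) (λ { left → refl ; stay → refl ; right → refl })

Vec↔ : ∀ {A : Set} {N} → A ↔ Fin N → ∀ m → Vec A m ↔ Fin (N ^ m)
Vec↔ f zero    = proj₂ ⊤ᶠ ↔-∘ mk↔ₛ′ (λ _ → tt) (λ _ → []) (λ _ → refl) (λ { [] → refl })
Vec↔ {A} f (suc m) = proj₂ ((_ , f) ×ᶠ (_ , Vec↔ f m)) ↔-∘ mk↔ₛ′ uncons cons (λ _ → refl) (λ { (b ∷ w) → refl })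
  where
  cons : A × Vec A m → Vec A (suc m)
  cons (b , w) = b ∷ w

Vecᶠ : ∀ {A} → Finite A → ∀ m → Finite (Vec A m)
Vecᶠ (N , f) m = N ^ m , Vec↔ f m

-- Register programs as probabilistic machines

module Assembly {V : Set} {R : ℕ} (Vᶠ : Finite V) (P : Prog V (RegAct V R)) (v₀ : V) (out : V → Bool) where
  open Tracks {V} {R} using (regCode; regCost; regRefines; module Stores)
  open Blocks {V × Bool} {3 + R} using (blockCode; blockCost; blockRefines; module Layout)

  -- A blank tape is almost the encoding of zero registers and empty arrays; only the origin mark in
  -- cell `0` is missing, and the first instruction sets it.
  cellProgram : Prog (V × Bool) (CellAct (V × Bool) (3 + R))
  cellProgram = act (λ v i c r → v , (true ∷ tail c) , stay , stay) ⨾ compile proj₁ regCode P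

  BlockMem : Set
  BlockMem = (V × Bool) × Vec Bool (3 + R) × Move

  tapeProgram : Prog BlockMem (TapeAct BlockMem)
  tapeProgram = compile proj₁ blockCode cellProgram

  output : BlockMem → Bool
  output ((v , _) , _) = out v

  controlᶠ : Finite (Control tapeProgram)
  controlᶠ = (Posᶠ tapeProgram ×ᶠ (Vᶠ ×ᶠ Boolᶠ) ×ᶠ Vecᶠ Boolᶠ (3 + R) ×ᶠ Moveᶠ) ⊎ᶠ Boolᶠ

  cellCost tapeCost : ℕ → ℕ
  cellCost m = 1 + suc (regCost m) * m
  tapeCost m = suc blockCost * cellCost m

  tapeCostᵖ : ∀ {f} → Poly f → Poly (λ n → tapeCost (f n))
  tapeCostᵖ p = constᵖ (suc blockCost) *ᵖ (constᵖ 1 +ᵖ (constᵖ 1 +ᵖ (walkᵖ +ᵖ (constᵖ 1 +ᵖ (constᵖ 1 +ᵖ walkᵖ)))) *ᵖ p)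
    where
    walkᵖ = constᵖ 2 +ᵖ p *ᵖ constᵖ 3

  blank : BlockMem
  blank = (v₀ , false) , replicate (3 + R) false , stay

  open Machine tapeProgram blank output controlᶠ public using (machine)

  module _ (x : List Bool) (ρ : ℕ → Bool) where

    cell-run : ∀ {m σ} →
      Run (regModel x ρ) P (mkRegs v₀ 0 (replicate R 0) (λ _ → false) (λ _ → false)) m σ →
      Σ (CellTape (V × Bool) (3 + R)) λ σ′ →
        Run (cellModel x ρ) cellProgram (mkCells (v₀ , false) 0 (λ _ → replicate (3 + R) false) 0) (cellCost m) σ′
        × proj₁ (CellTape.mem σ′) ≡ RegState.mem σ
    cell-run {m} run
      with refine (regRefines x ρ m) {b = 0}
             {σ = mkCells (v₀ , false) 0 (upd (λ _ → replicate (3 + R) false) 0 (true ∷ replicate (2 + R) false)) 0}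
             run ≤-refl
             (Tracks.stores refl refl refl
               (λ { zero    → cong (λ z → true ∷ false ∷ false ∷ z) (sym (map-replicate (0 <ᵇ_) 0 R))
                  ; (suc q) → cong (λ z → false ∷ false ∷ false ∷ z) (sym (map-replicate (suc q <ᵇ_) 0 R)) })
               (λ r → ≤-reflexive (lookup-replicate r 0)))
    ... | σ′ , run′ , R′ = σ′ , seq act run′ , Stores.mem≡ R′

    tape-run : ∀ {m σ} →
      Run (regModel x ρ) P (mkRegs v₀ 0 (replicate R 0) (λ _ → false) (λ _ → false)) m σ →
      Σ (Tape BlockMem) λ σ′ →
        Run (tapeModel x ρ) tapeProgram (mkTape blank 0 (λ _ → false) 0 0) (tapeCost m) σ′
        × proj₁ (proj₁ (Tape.mem σ′)) ≡ RegState.mem σ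
    tape-run {m} run with cell-run run
    ... | σ₂ , run₂ , mem₂
      with refine (blockRefines x ρ (cellCost m)) {b = 0} {σ = mkTape blank 0 (λ _ → false) 0 0} run₂ ≤-refl
             (Blocks.layout refl refl refl refl (λ q {j} _ → sym (readV-replicate (3 + R) j)))
    ... | σ₁ , run₁ , R₁ = σ₁ , run₁ , trans (cong proj₁ (Layout.mem≡ R₁)) mem₂

  machine-output : ∀ x {t} (r : Vec Bool t) {m σ} →
    Run (regModel x (readV r)) P (mkRegs v₀ 0 (replicate R 0) (λ _ → false) (λ _ → false)) m σ →
    tapeCost m < t → probOutput machine x t r ≡ just (out (RegState.mem σ))
  machine-output x r run lt =
    let σ₁ , run₁ , mem₁ = tape-run x (readV r) run in
    trans (Machine.probOutput-run tapeProgram blank output controlᶠ x r run₁ lt) (cong (λ v → just (out v)) mem₁)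

-- Injections between finite sets and counting of tapes

finite-≤ : ∀ {A B : Set} (F : Finite A) (G : Finite B) (f : A → B) → Injective _≡_ _≡_ f → proj₁ F ≤ proj₁ G
finite-≤ (_ , F) (_ , G) f inj = injective⇒≤ {f = Inverse.to G ∘ f ∘ Inverse.from F} λ e →
  trans (sym (Inverse.strictlyInverseˡ F _)) (trans (cong (Inverse.to F) (inj (to-injective e))) (Inverse.strictlyInverseˡ F _))
  where
  to-injective : ∀ {x y} → Inverse.to G x ≡ Inverse.to G y → x ≡ y
  to-injective {x} {y} e =
    trans (sym (Inverse.strictlyInverseʳ G x)) (trans (cong (Inverse.from G) e) (Inverse.strictlyInverseʳ G y))

unique-lookup-injective : ∀ {A : Set} {xs : List A} → Unique xs → ∀ {i j} → List.lookup xs i ≡ List.lookup xs j → i ≡ j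
unique-lookup-injective {xs = x ∷ xs} (px ∷ u) {Fin.zero}  {Fin.zero}  e = refl
unique-lookup-injective {xs = x ∷ xs} (px ∷ u) {Fin.zero}  {Fin.suc j} e = contradiction e (All.lookup px (∈-lookup j))
unique-lookup-injective {xs = x ∷ xs} (px ∷ u) {Fin.suc i} {Fin.zero}  e = contradiction (sym e) (All.lookup px (∈-lookup i))
unique-lookup-injective {xs = x ∷ xs} (px ∷ u) {Fin.suc i} {Fin.suc j} e = cong Fin.suc (unique-lookup-injective u e)

allVecs-unique : ∀ m → Unique (allVecs m)
allVecs-unique zero    = All.[] ∷ []
allVecs-unique (suc m) = Unique.++⁺ (Unique.map⁺ ∷-injectiveʳ (allVecs-unique m)) (Unique.map⁺ ∷-injectiveʳ (allVecs-unique m))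
  λ (p , q) → disjoint (∈-map⁻ _ p) (∈-map⁻ _ q)
  where
  disjoint : ∀ {v : Vec Bool (suc m)} → Σ (Vec Bool m) (λ u → u ∈ allVecs m × v ≡ true ∷ u) →
             ¬ Σ (Vec Bool m) (λ u → u ∈ allVecs m × v ≡ false ∷ u)
  disjoint (_ , _ , refl) (_ , _ , ())

length-allVecs : ∀ m → length (allVecs m) ≡ 2 ^ m
length-allVecs zero    = refl
length-allVecs (suc m) = begin
  length (List.map (true ∷_) (allVecs m) ++ List.map (false ∷_) (allVecs m))        ≡⟨ length-++ (List.map (true ∷_) (allVecs m)) ⟩
  length (List.map (true ∷_) (allVecs m)) + length (List.map (false ∷_) (allVecs m)) ≡⟨ cong₂ _+_ (length-map _ (allVecs m)) (length-map _ (allVecs m)) ⟩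
  length (allVecs m) + length (allVecs m)                                 ≡⟨ cong₂ _+_ (length-allVecs m) (trans (length-allVecs m) (sym (+-identityʳ _))) ⟩
  2 ^ suc m                                                               ∎
  where open ≡-Reasoning

-- Counting with Boolean predicates

count : ∀ {A : Set} → (A → Bool) → List A → ℕ
count p []       = 0
count p (x ∷ xs) = (if p x then 1 else 0) + count p xs

count-++ : ∀ {A : Set} (p : A → Bool) xs ys → count p (xs ++ ys) ≡ count p xs + count p ys
count-++ p []       ys = refl
count-++ p (x ∷ xs) ys = trans (cong ((if p x then 1 else 0) +_) (count-++ p xs ys)) (sym (+-assoc (if p x then 1 else 0) _ _))

count-map : ∀ {A B : Set} (p : B → Bool) (f : A → B) xs → count p (List.map f xs) ≡ count (p ∘ f) xs
count-map p f []       = refl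
count-map p f (x ∷ xs) = cong ((if p (f x) then 1 else 0) +_) (count-map p f xs)

count-const : ∀ {A : Set} b (xs : List A) → count (λ _ → b) xs ≡ (if b then 1 else 0) * length xs
count-const true  []       = refl
count-const true  (x ∷ xs) = cong suc (count-const true xs)
count-const false []       = refl
count-const false (x ∷ xs) = count-const false xs

length-filter : ∀ {A : Set} (p : A → Bool) xs → length (List.filter (T? ∘ p) xs) ≡ count p xs
length-filter p []       = refl
length-filter p (x ∷ xs) with p x
... | true  = cong suc (length-filter p xs)
... | false = length-filter p xs

markov : ∀ {A : Set} (f : A → ℕ) D xs → count (λ a → D <ᵇ f a) xs * suc D ≤ sum (List.map f xs)
markov f D []       = z≤n
markov f D (x ∷ xs) with D <ᵇ f x in e
... | true  = +-mono-≤ (<ᵇ⇒< D (f x) (subst T (sym e) tt)) (markov f D xs)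
... | false = ≤-trans (markov f D xs) (m≤n+m _ (f x))

-- Used with `p` for far tapes and `q` for tapes that halt in time; the class in the middle is then
-- that of the slow tapes.
count-cover : ∀ {A : Set} (p q : A → Bool) xs →
              length xs ≤ count p xs + count (λ a → not (p a) ∧ not (q a)) xs + count q xs
count-cover p q []       = z≤n
count-cover p q (x ∷ xs) with p x | q x | count-cover p q xs
... | true  | true  | ih = s≤s (≤-trans ih (+-monoʳ-≤ (count p xs + _) (n≤1+n _)))
... | true  | false | ih = s≤s ih
... | false | true  | ih = ≤-trans (s≤s ih) (≤-reflexive (sym (+-suc _ (count q xs))))
... | false | false | ih = ≤-trans (s≤s ih) (≤-reflexive (cong (_+ count q xs) (sym (+-suc (count p xs) _))))

-- Padding with `false` agrees with how a random tape reads beyond its end, so `readV-prefix` holds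
-- for all lengths.
prefix : ∀ c {t} → Vec Bool t → Vec Bool c
prefix zero    r       = []
prefix (suc c) []      = false ∷ prefix c []
prefix (suc c) (b ∷ r) = b ∷ prefix c r

readV-prefix : ∀ c {t} (r : Vec Bool t) {p} → p < c → readV r p ≡ readV (prefix c r) p
readV-prefix (suc c) []      {zero}  l       = refl
readV-prefix (suc c) []      {suc p} (s≤s l) = readV-prefix c [] l
readV-prefix (suc c) (b ∷ r) {zero}  l       = refl
readV-prefix (suc c) (b ∷ r) {suc p} (s≤s l) = readV-prefix c r l

-- A prefix of a uniform tape is uniform, stated without division. The induction splits both lists
-- by the first bit, which `prefix` preserves.
count-prefix : ∀ {c t} (H : Vec Bool c → Bool) → c ≤ t →
               count (H ∘ prefix c) (allVecs t) * 2 ^ c ≡ count H (allVecs c) * 2 ^ t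
count-prefix {zero} {t} H z≤n = begin
  count (λ _ → H []) (allVecs t) * 1           ≡⟨ *-identityʳ _ ⟩
  count (λ _ → H []) (allVecs t)               ≡⟨ count-const (H []) (allVecs t) ⟩
  (if H [] then 1 else 0) * length (allVecs t) ≡⟨ cong₂ _*_ (sym (+-identityʳ (if H [] then 1 else 0))) (length-allVecs t) ⟩
  ((if H [] then 1 else 0) + 0) * 2 ^ t        ∎
  where open ≡-Reasoning
count-prefix {suc c} {suc t} H (s≤s l) = begin
  count (H ∘ prefix (suc c)) (allVecs (suc t)) * 2 ^ suc c                    ≡⟨ cong (_* 2 ^ suc c) (halves t (H ∘ prefix (suc c))) ⟩
  (count (H₁ ∘ prefix c) (allVecs t) + count (H₀ ∘ prefix c) (allVecs t)) * 2 ^ suc c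
    ≡⟨ regroup (count (H₁ ∘ prefix c) (allVecs t)) (count (H₀ ∘ prefix c) (allVecs t)) (2 ^ c) ⟩
  2 * (count (H₁ ∘ prefix c) (allVecs t) * 2 ^ c + count (H₀ ∘ prefix c) (allVecs t) * 2 ^ c)
    ≡⟨ cong (2 *_) (cong₂ _+_ (count-prefix H₁ l) (count-prefix H₀ l)) ⟩
  2 * (count H₁ (allVecs c) * 2 ^ t + count H₀ (allVecs c) * 2 ^ t)           ≡⟨ regroup (count H₁ (allVecs c)) (count H₀ (allVecs c)) (2 ^ t) ⟨
  (count H₁ (allVecs c) + count H₀ (allVecs c)) * 2 ^ suc t                   ≡⟨ cong (_* 2 ^ suc t) (halves c H) ⟨
  count H (allVecs (suc c)) * 2 ^ suc t                                       ∎
  where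
  open ≡-Reasoning
  H₁ H₀ : Vec Bool c → Bool
  H₁ = H ∘ (true ∷_)
  H₀ = H ∘ (false ∷_)
  halves : ∀ m (p : Vec Bool (suc m) → Bool) →
           count p (allVecs (suc m)) ≡ count (p ∘ (true ∷_)) (allVecs m) + count (p ∘ (false ∷_)) (allVecs m)
  halves m p = trans (count-++ p (List.map (true ∷_) (allVecs m)) _) (cong₂ _+_ (count-map p _ (allVecs m)) (count-map p _ (allVecs m)))
  regroup : ∀ a b y → (a + b) * (2 * y) ≡ 2 * (a * y + b * y)
  regroup = solve-∀

countOut-hit : ∀ {t} (f : Vec Bool t → Maybe Bool) b r rs → f r ≡ just b →
               suc (countOut f b rs) ≤ countOut f b (r ∷ rs)
countOut-hit f true  r rs e rewrite e = ≤-refl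
countOut-hit f false r rs e rewrite e = ≤-refl

countOut-skip : ∀ {t} (f : Vec Bool t → Maybe Bool) b r rs → countOut f b rs ≤ countOut f b (r ∷ rs)
countOut-skip f b r rs with f r
... | just true  = m≤n+m _ _
... | just false = m≤n+m _ _
... | nothing    = ≤-refl

count≤countOut : ∀ {t} (f : Vec Bool t → Maybe Bool) b (p : Vec Bool t → Bool) →
                 (∀ r → p r ≡ true → f r ≡ just b) → ∀ rs → count p rs ≤ countOut f b rs
count≤countOut f b p h []       = z≤n
count≤countOut f b p h (r ∷ rs) with p r in e
... | true  = ≤-trans (s≤s (count≤countOut f b p h rs)) (countOut-hit f b r rs (h r e))
... | false = ≤-trans (count≤countOut f b p h rs) (countOut-skip f b r rs)

-- Flipping at most D bits

flipAt : ∀ {c} → ℕ → Vec Bool c → Vec Bool c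
flipAt i       []      = []
flipAt zero    (b ∷ w) = not b ∷ w
flipAt (suc i) (b ∷ w) = b ∷ flipAt i w

-- Exactly `D` flips are always recorded, so a tape that already agrees needs a flip without effect;
-- the extra index `c` in `Fin (suc c)`, just past the end, provides it.
hamming-flip : ∀ {c} (u w : Vec Bool c) {D} → hamming u w ≤ suc D → Σ (Fin (suc c)) λ i → hamming u (flipAt (toℕ i) w) ≤ D
hamming-flip []          []          l = Fin.zero , z≤n
hamming-flip (true  ∷ u) (false ∷ w) l = Fin.zero , s≤s⁻¹ l
hamming-flip (false ∷ u) (true  ∷ w) l = Fin.zero , s≤s⁻¹ l
hamming-flip (true  ∷ u) (true  ∷ w) l with hamming-flip u w l
... | i , l′ = Fin.suc i , l′
hamming-flip (false ∷ u) (false ∷ w) l with hamming-flip u w l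
... | i , l′ = Fin.suc i , l′

hamming-0 : ∀ {c} (u w : Vec Bool c) → hamming u w ≤ 0 → w ≡ u
hamming-0 []          []          l = refl
hamming-0 (true  ∷ u) (true  ∷ w) l = cong (true ∷_) (hamming-0 u w l)
hamming-0 (false ∷ u) (false ∷ w) l = cong (false ∷_) (hamming-0 u w l)

flips : ∀ {c D} → Vec (Fin (suc c)) D → Vec Bool c → Vec Bool c
flips []       w = w
flips (i ∷ is) w = flips is (flipAt (toℕ i) w)

hamming-flips : ∀ {c} D (u w : Vec Bool c) → hamming u w ≤ D → Σ (Vec (Fin (suc c)) D) λ is → flips is w ≡ u
hamming-flips zero    u w l = [] , hamming-0 u w l
hamming-flips (suc D) u w l with hamming-flip u w l
... | i , l′ with hamming-flips D u (flipAt (toℕ i) w) l′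
... | is , e = i ∷ is , e

-- Orbits that reach a fixed point

iter-+ : ∀ {A : Set} a b (f : A → A) z → iter (a + b) f z ≡ iter a f (iter b f z)
iter-+ zero    b f z = refl
iter-+ (suc a) b f z = cong f (iter-+ a b f z)

iter-periodic : ∀ {A : Set} m d (f : A → A) {z} → iter d f z ≡ z → iter (m * d) f z ≡ z
iter-periodic zero    d f e = refl
iter-periodic (suc m) d f {z} e = trans (iter-+ d (m * d) f z) (trans (cong (iter d f) (iter-periodic m d f e)) e)

module Orbit {A : Set} (f : A → A) (z : A) (F : ℕ) (fixed : f (iter F f z) ≡ iter F f z) where

  beyond : ∀ {t} → F ≤ t → iter t f z ≡ iter F f z
  beyond {t} l = trans (cong (λ k → iter k f z) (sym (m∸n+n≡m l))) (trans (iter-+ (t ∸ F) F f z) (iter-fix (t ∸ F) f fixed))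

  from-any : ∀ t → iter F f (iter t f z) ≡ iter F f z
  from-any t = trans (sym (iter-+ F t f z)) (beyond (m≤m+n F t))

  -- A repetition makes the orbit periodic from time `t` with period `d ≥ 1`. After `F` periods the
  -- time is at least `F`, where the orbit is constant, so the repeated point is already the fixed
  -- point.
  repeat : ∀ {t t′} → t < t′ → iter t f z ≡ iter t′ f z → iter t f z ≡ iter F f z
  repeat {t} {t′} l e = trans (sym (iter-periodic F d f period)) (trans (sym (iter-+ (F * d) t f z)) (beyond F≤))
    where
    d = t′ ∸ t
    period : iter d f (iter t f z) ≡ iter t f z
    period = trans (sym (iter-+ d t f z)) (trans (cong (λ k → iter k f z) (m∸n+n≡m (<⇒≤ l))) (sym e))
    F≤ : F ≤ F * d + t
    F≤ = ≤-trans (≤-trans (≤-reflexive (sym (*-identityʳ F))) (*-monoʳ-≤ F (m<n⇒0<n∸m l))) (m≤m+n (F * d) t)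

move-bound : ∀ d m p {B} → p ≤ B → m ≤ B → move d m p ≤ B
move-bound left  m p l l′ = ≤-trans (m∸n≤m p 1) l
move-bound stay  m p l l′ = l
move-bound right m p l l′ with suc p ≤ᵇ m in e
... | true  = ≤-trans (≤ᵇ⇒≤ (suc p) m (subst T (sym e) tt)) l′
... | false = l

-- Few tapes are both near and slow

module Counting (M : CatMachine) (x : List Bool) (s c : ℕ) (answer : Bool)
                (correct : ∀ τ → catOutput M x s c τ ≡ just answer) where
  open CatMachine M

  n F : ℕ
  n = length x
  F = catFuel M n s c

  step : CatConfig s c Q → CatConfig s c Q
  step = catStep M x

  first : Vec Bool c → CatConfig s c Q
  first τ = cfg start 0 (replicate s false) 0 τ 0

  conf : Vec Bool c → ℕ → CatConfig s c Q
  conf τ t = iter t step (first τ)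

  haltedAt : ℕ → Vec Bool c → Bool
  haltedAt t τ = is-just (halt (CatConfig.state (conf τ t)))

  distance : Vec Bool c → ℕ
  distance τ = hamming τ (catFinalTape M x s c τ)

  step-fixed : ∀ (cf : CatConfig s c Q) → is-just (halt (CatConfig.state cf)) ≡ true → step cf ≡ cf
  step-fixed cf h with halt (CatConfig.state cf)
  ... | just _ = refl

  final-fixed : ∀ τ → step (conf τ F) ≡ conf τ F
  final-fixed τ = step-fixed (conf τ F) (cong is-just (correct τ))

  haltedAt-correct : ∀ t τ → haltedAt t τ ≡ true → halt (CatConfig.state (conf τ t)) ≡ just answer
  haltedAt-correct t τ h = trans (cong (halt ∘ CatConfig.state) conf≡) (correct τ)
    where
    conf≡ : conf τ t ≡ conf τ F
    conf≡ = trans (sym (iter-fix F step (step-fixed (conf τ t) h))) (Orbit.from-any step (first τ) F (final-fixed τ) t)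

  haltedAt-mono : ∀ {t t′} τ → t ≤ t′ → haltedAt t τ ≡ true → haltedAt t′ τ ≡ true
  haltedAt-mono {t} {t′} τ l h = trans (cong (is-just ∘ halt ∘ CatConfig.state) conf≡) h
    where
    conf≡ : conf τ t′ ≡ conf τ t
    conf≡ = trans (cong (conf τ) (sym (m∸n+n≡m l)))
              (trans (iter-+ (t′ ∸ t) t step (first τ)) (iter-fix (t′ ∸ t) step (step-fixed (conf τ t) h)))

  -- The bounds on the work and catalytic heads are not strict because a head stands at `0` even on
  -- a tape of length zero; this accounts for the factors `suc s` and `suc c` in the count.
  record Bounded (cf : CatConfig s c Q) : Set where
    constructor bounded
    open CatConfig cf
    field
      inPos≤ : inPos ≤ suc n
      wPos≤  : wPos ≤ s
      cPos≤  : cPos ≤ c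

  step-bounded : ∀ {cf} → Bounded cf → Bounded (step cf)
  step-bounded {cfg q i w wi τ ci} (bounded a b d) with halt q
  ... | just _  = bounded a b d
  ... | nothing with δ q (readIn x i) (readV w wi) (readV τ ci)
  ... | _ , _ , _ , mi , mw , mc =
    bounded (move-bound mi (suc n) i a ≤-refl) (move-bound mw (s ∸ 1) wi b (m∸n≤m s 1))
            (move-bound mc (c ∸ 1) ci d (m∸n≤m c 1))

  conf-bounded : ∀ τ t → Bounded (conf τ t)
  conf-bounded τ zero    = bounded z≤n z≤n z≤n
  conf-bounded τ (suc t) = step-bounded (conf-bounded τ t)

  Code : Set
  Code = Vec Bool c × Fin Q × Fin (2 + n) × Fin (suc s) × Vec Bool s × Fin (suc c)

  Codeᶠ : Finite Code
  Codeᶠ = Vecᶠ Boolᶠ c ×ᶠ Finᶠ Q ×ᶠ Finᶠ (2 + n) ×ᶠ Finᶠ (suc s) ×ᶠ Vecᶠ Boolᶠ s ×ᶠ Finᶠ (suc c)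

  code : ∀ cf → Bounded cf → Code
  code (cfg q i w wi τ ci) (bounded a b d) = τ , q , fromℕ< (s≤s a) , fromℕ< (s≤s b) , w , fromℕ< (s≤s d)

  code-injective : ∀ cf cf′ bd bd′ → code cf bd ≡ code cf′ bd′ → cf ≡ cf′
  code-injective (cfg q i w wi τ ci) (cfg q′ i′ w′ wi′ τ′ ci′) (bounded a b d) (bounded a′ b′ d′) e
    with cong proj₁ e | cong (proj₁ ∘ proj₂) e | fromℕ<-injective i i′ (s≤s a) (s≤s a′) (cong (proj₁ ∘ proj₂ ∘ proj₂) e)
       | fromℕ<-injective wi wi′ (s≤s b) (s≤s b′) (cong (proj₁ ∘ proj₂ ∘ proj₂ ∘ proj₂) e)
       | cong (proj₁ ∘ proj₂ ∘ proj₂ ∘ proj₂ ∘ proj₂) e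
       | fromℕ<-injective ci ci′ (s≤s d) (s≤s d′) (cong (proj₂ ∘ proj₂ ∘ proj₂ ∘ proj₂ ∘ proj₂) e)
  ... | refl | refl | refl | refl | refl | refl = refl

  module _ (D T₀ : ℕ) where

    far slow : Vec Bool c → Bool
    far  τ = D <ᵇ distance τ
    slow τ = not (far τ) ∧ not (haltedAt T₀ τ)

    slowList : List (Vec Bool c)
    slowList = List.filter (T? ∘ slow) (allVecs c)

    tape : Fin (length slowList) → Vec Bool c
    tape i = List.lookup slowList i

    T-not : ∀ {b} → T (not b) → b ≡ false
    T-not {false} _ = refl

    tape-slow : ∀ i → far (tape i) ≡ false × haltedAt T₀ (tape i) ≡ false
    tape-slow i =
      let (p , q) = Equivalence.to (T-∧ {not (far (tape i))}) (All.lookup (all-filter (T? ∘ slow) (allVecs c)) (∈-lookup i))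
      in T-not p , T-not q

    near : ∀ i → distance (tape i) ≤ D
    near i = ≮⇒≥ λ l → contradiction (trans (sym (proj₁ (tape-slow i))) (T⇒true (<⇒<ᵇ l))) λ ()

    correction : ∀ i → Σ (Vec (Fin (suc c)) D) λ is → flips is (catFinalTape M x s c (tape i)) ≡ tape i
    correction i = hamming-flips D (tape i) (catFinalTape M x s c (tape i)) (near i)

    encode-run : Fin (length slowList) × Fin T₀ → Vec (Fin (suc c)) D × Code
    encode-run (i , t) = proj₁ (correction i) , code (conf (tape i) (toℕ t)) (conf-bounded (tape i) (toℕ t))

    -- The final configuration is halting, and halting persists, so a slow tape cannot have reached
    -- it before `T₀`.
    not-final : ∀ i (t : Fin T₀) → conf (tape i) (toℕ t) ≢ conf (tape i) F
    not-final i t e = contradiction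
      (trans (sym (proj₂ (tape-slow i)))
        (haltedAt-mono (tape i) (<⇒≤ (toℕ<n t)) (trans (cong (is-just ∘ halt ∘ CatConfig.state) e) (cong is-just (correct (tape i))))))
      λ ()

    -- By `Orbit.repeat` a repeated configuration would be the final one, which `not-final`
    -- excludes.
    time-injective : ∀ i {t t′ : Fin T₀} → conf (tape i) (toℕ t) ≡ conf (tape i) (toℕ t′) → t ≡ t′
    time-injective i {t} {t′} e with <-cmp (toℕ t) (toℕ t′)
    ... | tri< l _ _ = contradiction (Orbit.repeat step (first (tape i)) F (final-fixed (tape i)) l e) (not-final i t)
    ... | tri≈ _ q _ = toℕ-injective q
    ... | tri> _ _ l = contradiction (Orbit.repeat step (first (tape i)) F (final-fixed (tape i)) l (sym e)) (not-final i t′)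

    -- A configuration determines the final tape, the corrections then give back
    -- the initial tape, and the run visits no configuration twice.
    encode-run-injective : Injective _≡_ _≡_ encode-run
    encode-run-injective {i , t} {j , t′} e = cong₂ _,_ i≡j (time-injective j (trans (cong (λ k → conf (tape k) (toℕ t)) (sym i≡j)) conf≡))
      where
      conf≡ : conf (tape i) (toℕ t) ≡ conf (tape j) (toℕ t′)
      conf≡ = code-injective _ _ (conf-bounded (tape i) (toℕ t)) (conf-bounded (tape j) (toℕ t′)) (cong proj₂ e)
      final≡ : conf (tape i) F ≡ conf (tape j) F
      final≡ = trans (sym (Orbit.from-any step _ F (final-fixed (tape i)) (toℕ t)))
                 (trans (cong (iter F step) conf≡) (Orbit.from-any step _ F (final-fixed (tape j)) (toℕ t′)))
      i≡j : i ≡ j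
      i≡j = unique-lookup-injective (Unique.filter⁺ (T? ∘ slow) (allVecs-unique c))
        (trans (sym (proj₂ (correction i)))
          (trans (cong₂ flips (cong proj₁ e) (cong CatConfig.cat final≡)) (proj₂ (correction j))))

    slow-bound : count slow (allVecs c) * T₀ ≤ suc c ^ D * (2 ^ c * (Q * ((2 + n) * (suc s * (2 ^ s * suc c)))))
    slow-bound = ≤-trans (≤-reflexive (cong (_* T₀) (sym (length-filter slow (allVecs c)))))
      (finite-≤ (Finᶠ (length slowList) ×ᶠ Finᶠ T₀) (Vecᶠ (Finᶠ (suc c)) D ×ᶠ Codeᶠ) encode-run encode-run-injective)

-- Polynomial running time and error estimate

simCostᵖ : ∀ k K → Poly (λ n → simCost n k K)
simCostᵖ k K = setupᵖ +ᵖ (constᵖ 1 +ᵖ (constᵖ 1 +ᵖ polyTimeᵖ K *ᵖ constᵖ 18))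
  where
  addᵖ : Poly addCost
  addᵖ = constᵖ 6 +ᵖ idᵖ *ᵖ constᵖ 5
  powᵖ : ∀ e → Poly (λ n → powCost n e)
  powᵖ zero    = constᵖ 1
  powᵖ (suc e) = powᵖ e +ᵖ ((constᵖ 2 +ᵖ idᵖ ^ᵖ e *ᵖ (constᵖ 3 +ᵖ addᵖ)) +ᵖ (constᵖ 2 +ᵖ idᵖ ^ᵖ e *ᵖ idᵖ *ᵖ constᵖ 4))
  logᵖ : Poly (λ n → logCost n k)
  logᵖ = addᵖ +ᵖ (constᵖ 1 +ᵖ (constᵖ 1 +ᵖ (constᵖ 1 +ᵖ idᵖ *ᵖ (constᵖ 7 +ᵖ constᵖ k +ᵖ idᵖ *ᵖ constᵖ 11))))
  setupᵖ : Poly (λ n → setupCost n k K)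
  setupᵖ = powᵖ K +ᵖ ((constᵖ 2 +ᵖ idᵖ ^ᵖ K *ᵖ constᵖ 4) +ᵖ (constᵖ (suc K) +ᵖ
           (powᵖ k +ᵖ ((constᵖ 2 +ᵖ idᵖ ^ᵖ k *ᵖ constᵖ 4) +ᵖ logᵖ))))

-- From `a ≤ m * y / X` and `X ≥ 6 * (m + 1)` it follows that `a` is at most a sixth of `y`. The
-- successor allows cancellation also for `m = 0`. The instances are `m = C` for far tapes and
-- `m = configs n` for slow ones.
sixth-bound : ∀ a m {X y} → 6 * suc m ≤ X → a * X ≤ m * y → 6 * a ≤ y
sixth-bound a m {X} {y} l h = *-cancelˡ-≤ (suc m) (begin
  suc m * (6 * a)   ≡⟨ lin m a ⟩
  a * (6 * suc m)   ≤⟨ *-monoʳ-≤ a l ⟩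
  a * X             ≤⟨ h ⟩
  m * y             ≤⟨ *-monoˡ-≤ y (n≤1+n m) ⟩
  suc m * y         ∎)
  where
  open ≤-Reasoning
  lin : ∀ m a → suc m * (6 * a) ≡ a * (6 * suc m)
  lin = solve-∀

two-thirds : ∀ a b h {y} → y ≤ a + b + h → 6 * a ≤ y → 6 * b ≤ y → 2 * y ≤ 3 * h
two-thirds a b h {y} l la lb = *-cancelˡ-≤ 2 (+-cancelˡ-≤ (2 * y) _ _ (begin
  2 * y + 2 * (2 * y)        ≡⟨ lin y ⟩
  6 * y                      ≤⟨ *-monoʳ-≤ 6 l ⟩
  6 * (a + b + h)            ≡⟨ lin′ a b h ⟩
  6 * a + 6 * b + 6 * h      ≤⟨ +-monoˡ-≤ (6 * h) (+-mono-≤ la lb) ⟩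
  y + y + 6 * h              ≡⟨ lin″ y h ⟩
  2 * y + 2 * (3 * h)        ∎))
  where
  open ≤-Reasoning
  lin : ∀ y → 2 * y + 2 * (2 * y) ≡ 6 * y
  lin = solve-∀
  lin′ : ∀ a b h → 6 * (a + b + h) ≡ 6 * a + 6 * b + 6 * h
  lin′ = solve-∀
  lin″ : ∀ y h → y + y + 6 * h ≡ 2 * y + 2 * (3 * h)
  lin″ = solve-∀

module Conclusion (L : Language) (k C : ℕ) (M : CatMachine)
  (correct : ∀ x τ → catOutput M x (workSpace k (length x)) (catSpace k (length x)) τ ≡ just (L x))
  (average : ∀ x → sum (List.map (λ τ → hamming τ (catFinalTape M x (workSpace k (length x)) (catSpace k (length x)) τ))
                            (allVecs (catSpace k (length x)))) ≤ C * 2 ^ catSpace k (length x)) where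
  open CatMachine M
  open Setup {Q} using (V)

  D : ℕ
  D = 6 * suc C

  -- The right-hand side of `slow-bound` without its factor `2 ^ c`; what remains, corrections
  -- included, is polynomial in `n` and determines the deadline.
  configs : ℕ → ℕ
  configs n = suc (catSpace k n) ^ D * (Q * ((2 + n) * (suc (workSpace k n) * (2 ^ workSpace k n * suc (catSpace k n)))))

  clockᵖ : Poly (λ n → 6 * suc (configs n))
  clockᵖ = constᵖ 6 *ᵖ (constᵖ 1 +ᵖ (constᵖ 1 +ᵖ catSpaceᵖ k) ^ᵖ D *ᵖ (constᵖ Q *ᵖ ((constᵖ 2 +ᵖ idᵖ) *ᵖ
           ((constᵖ 1 +ᵖ workSpaceᵖ k) *ᵖ (2^workSpaceᵖ k *ᵖ (constᵖ 1 +ᵖ catSpaceᵖ k))))))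

  module Clocked (K : ℕ) (K-bound : ∀ n → 6 * suc (configs n) ≤ polyTime K n) where

    -- An answer is due on every random tape, so a run still going at the deadline gets `false`; the
    -- estimate gives no credit for such tapes.
    verdict : ∀ x → Vec Bool (catSpace k (length x)) → Bool
    verdict x τ = fromMaybe false (halt (CatConfig.state (iter (polyTime K (length x)) (catStep M x)
      (cfg start 0 (replicate (workSpace k (length x)) false) 0 τ 0))))

    success : ∀ x {t} (f : Vec Bool t → Maybe Bool) → catSpace k (length x) ≤ t →
              (∀ r → f r ≡ just (verdict x (prefix (catSpace k (length x)) r))) →
              2 * 2 ^ t ≤ 3 * countOut f (L x) (allVecs t)
    success x {t} f c≤t simulated = ≤-trans (*-cancelʳ-≤ _ _ (2 ^ c) {{m^n≢0 2 c}} (begin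
        2 * 2 ^ t * 2 ^ c                                 ≡⟨ lin (2 ^ t) (2 ^ c) ⟩
        2 * 2 ^ c * 2 ^ t                                 ≤⟨ *-monoˡ-≤ (2 ^ t) many-good ⟩
        3 * count good (allVecs c) * 2 ^ t                ≡⟨ *-assoc 3 (count good (allVecs c)) (2 ^ t) ⟩
        3 * (count good (allVecs c) * 2 ^ t)              ≡⟨ cong (3 *_) (count-prefix good c≤t) ⟨
        3 * (count (good ∘ prefix c) (allVecs t) * 2 ^ c) ≡⟨ *-assoc 3 (count (good ∘ prefix c) (allVecs t)) (2 ^ c) ⟨
        3 * count (good ∘ prefix c) (allVecs t) * 2 ^ c   ∎))
      (*-monoʳ-≤ 3 (count≤countOut f (L x) (good ∘ prefix c) good-correct (allVecs t)))
      where
      open ≤-Reasoning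
      n = length x
      T₀ = polyTime K n
      c = catSpace k n
      open Counting M x (workSpace k n) c (L x) (correct x) using (far; slow; haltedAt; haltedAt-correct; distance; slow-bound)
      good : Vec Bool c → Bool
      good = haltedAt T₀
      good-correct : ∀ r → good (prefix c r) ≡ true → f r ≡ just (L x)
      good-correct r g = trans (simulated r) (cong (λ z → just (fromMaybe false z)) (haltedAt-correct T₀ (prefix c r) g))
      few-far : 6 * count (far D T₀) (allVecs c) ≤ 2 ^ c
      few-far = sixth-bound (count (far D T₀) (allVecs c)) C (n≤1+n D) (≤-trans (markov distance D (allVecs c)) (average x))
      few-slow : 6 * count (slow D T₀) (allVecs c) ≤ 2 ^ c
      few-slow = sixth-bound (count (slow D T₀) (allVecs c)) (configs n) (K-bound n) (≤-trans (slow-bound D T₀) (≤-reflexive (swap (suc c ^ D) (2 ^ c) _)))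
        where
        swap : ∀ a b d → a * (b * d) ≡ a * d * b
        swap = solve-∀
      many-good : 2 * 2 ^ c ≤ 3 * count good (allVecs c)
      many-good = two-thirds (count (far D T₀) (allVecs c)) (count (slow D T₀) (allVecs c)) (count good (allVecs c))
                    (≤-trans (≤-reflexive (sym (length-allVecs c))) (count-cover (far D T₀) good (allVecs c)))
                    few-far few-slow
      lin : ∀ a b → 2 * a * b ≡ 2 * b * a
      lin = solve-∀

    v₀ : V
    v₀ = start , false , false , stay , stay

    out : V → Bool
    out (q , _) = fromMaybe false (halt q)

    Vᶠ : Finite V
    Vᶠ = Finᶠ Q ×ᶠ Boolᶠ ×ᶠ Boolᶠ ×ᶠ Moveᶠ ×ᶠ Moveᶠ

    open Assembly Vᶠ (Simulation.program M k K) v₀ out using (machine; machine-output; tapeCost; tapeCostᵖ)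

    simulated : ∀ x {t} (r : Vec Bool t) → tapeCost (simCost (length x) k K) < t →
                probOutput machine x t r ≡ just (verdict x (prefix (catSpace k (length x)) r))
    simulated x r lt =
      let σ , run , state≡ = Simulation.program-run M x (readV r) k K false (stay , stay) (prefix (catSpace k (length x)) r)
                               (readV-prefix (catSpace k (length x)) r)
      in trans (machine-output x r run lt) (cong (λ q → just (fromMaybe false (halt q))) state≡)

    -- The one exponent `E` has to dominate the running time, which also limits how far the heads
    -- go, and the catalytic length, so that `τ` fits on the random tape.
    inBPP : (𝓟 : ProbMachine) (time : ℕ → ℕ) → Poly time →
            (∀ x {t} (r : Vec Bool t) → time (length x) < t →
              probOutput 𝓟 x t r ≡ just (verdict x (prefix (catSpace k (length x)) r))) →
            BPP L
    inBPP 𝓟 time timeᵖ sim = E , 𝓟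
      , (λ x r → _ , sim x r (time< (length x)))
      , (λ x → success x (probOutput 𝓟 x (polyTime E (length x))) (space≤ (length x)) (λ r → sim x r (time< (length x))))
      where
      bound : Σ ℕ λ E → ∀ n → suc (time n) + catSpace k n ≤ polyTime E n
      bound = poly⇒polyTime (constᵖ 1 +ᵖ timeᵖ +ᵖ catSpaceᵖ k)
      E = proj₁ bound
      time< : ∀ n → time n < polyTime E n
      time< n = m+n≤o⇒m≤o (suc (time n)) (proj₂ bound n)
      space≤ : ∀ n → catSpace k n ≤ polyTime E n
      space≤ n = m+n≤o⇒n≤o (suc (time n)) (proj₂ bound n)

    conclusion : BPP L
    conclusion = inBPP machine (λ n → tapeCost (simCost n k K)) (tapeCostᵖ (simCostᵖ k K)) simulated

theorem6p8 : (L : Language) → AvgCatLCL L → BPP L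
theorem6p8 L (k , C , M , correct , average) =
  let open Conclusion L k C M correct average
      K , K-bound = poly⇒polyTime clockᵖ
  in Clocked.conclusion K K-bound
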